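{- Let $k$ be any positive integer. There is a semi-streaming algorithm which, given any undirected graph $G=(V,E)$ with $n$ vertices and $m$ edges (presented as an edge stream), computes a DFS tree of $G$ in at most $\lceil n/k\rceil$ passes over the stream, using $O(nk)$ space and $O(m\,\alpha(m,n))$ time per pass, where $\alpha(m,n)$ is the inverse Ackermann function.
   Context: Streaming model: the vertex set $V$, $|V|=n$, is known, and the $m$ edges of $E$ are accessible only as a stream. One pass reads all edges of $E$ once, one after another, in an arbitrary order. The algorithm may perform several passes, and between consecutive edges it may do computation using only its local storage. The space bound limits the size of the local storage at all times (measured in words, each able to hold a vertex identifier or an edge in $O(1)$ words). DFS tree: a rooted spanning tree of a connected undirected graph is a DFS tree if and only if every non-tree edge is a back edge, i.e. one of its endpoints is an ancestor of the other in the tree. Convention: $G$ is taken to be connected. A disconnected graph is handled by adding a dummy vertex $r$ adjacent to all vertices and computing a DFS tree rooted at $r$ of the augmented graph (each child subtree of $r$ is then a DFS tree of a connected component of the original graph). -}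

module Defs where

open import Data.Bool.Base using (if_then_else_)
open import Data.Fin.Base using (Fin; toℕ)
open import Data.List.Base using (List; []; _∷_; length)
open import Data.List.Relation.Binary.Permutation.Homogeneous using (Permutation)
open import Data.List.Relation.Unary.All using (All)
open import Data.List.Relation.Unary.AllPairs using (AllPairs)
open import Data.List.Relation.Unary.Any using (Any)
open import Data.Nat.Base
open import Data.Nat.DivMod using (_/_)
open import Data.Nat.Logarithm using (⌈log₂_⌉; ⌈log₂⌉-mono-≤; ⌈log₂2^n⌉≡n)
open import Data.Nat.Properties
open import Data.Product.Base using (_×_; _,_; ∃; proj₁; swap)
open import Data.Sum.Base using (_⊎_)
open import Function.Base using (_∘_)
open import Relation.Binary.Construct.Closure.ReflexiveTransitive using (Star)
open import Relation.Binary.PropositionalEquality using (_≡_; _≢_; cong; subst)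
open import Relation.Nullary using (¬_; yes; no)
open import Relation.Unary using (Decidable)

------------------------------------------------------------------------
-- Finite simple graphs and DFS trees

Edge : ℕ → Set
Edge n = Fin n × Fin n

-- Edges are unordered: (u , v) and (v , u) are the same edge.
SameEdge : ∀ {n} → Edge n → Edge n → Set
SameEdge e f = e ≡ f ⊎ e ≡ swap f

record Graph (n : ℕ) : Set where
  field
    edges    : List (Edge n)
    loopless : All (λ (u , v) → u ≢ v) edges
    simple   : AllPairs (λ e f → ¬ SameEdge e f) edges

  size : ℕ
  size = length edges

  Adj : Fin n → Fin n → Set
  Adj u v = Any (SameEdge (u , v)) edges

open Graph public

Connected : ∀ {n} → Graph n → Set
Connected G = ∀ u v → Star (Adj G) u v

-- A rooted tree is given by its parent function; the root is its own parent.
-- Every vertex is an ancestor of itself.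
Ancestor : ∀ {n} → (Fin n → Fin n) → Fin n → Fin n → Set
Ancestor parent u v = Star (λ x y → parent x ≡ y) v u

TreeEdge : ∀ {n} → Fin n → (Fin n → Fin n) → Fin n → Fin n → Set
TreeEdge root parent u v =
  (u ≢ root × parent u ≡ v) ⊎ (v ≢ root × parent v ≡ u)

record IsRootedSpanningTree {n} (G : Graph n)
         (root : Fin n) (parent : Fin n → Fin n) : Set where
  field
    parent-root : parent root ≡ root
    parent-adj  : ∀ v → v ≢ root → Adj G v (parent v)
    reaches     : ∀ v → Ancestor parent root v

record IsDFSTree {n} (G : Graph n)
         (root : Fin n) (parent : Fin n → Fin n) : Set where
  field
    isRootedSpanningTree : IsRootedSpanningTree G root parent
    nonTree⇒back         : ∀ u v → Adj G u v → ¬ TreeEdge root parent u v →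
                           Ancestor parent u v ⊎ Ancestor parent v u

------------------------------------------------------------------------
-- Inverse Ackermann function

ackermann : ℕ → ℕ → ℕ
ackermann zero    x       = suc x
ackermann (suc i) zero    = ackermann i 1
ackermann (suc i) (suc x) = ackermann i (ackermann (suc i) x)

private
  i+x<ackermann : ∀ i x → i + x < ackermann i x
  i+x<ackermann zero    x       = ≤-refl
  i+x<ackermann (suc i) zero    = begin-strict
    suc i + 0       ≡⟨ +-suc i 0 ⟨
    i + 1           <⟨ i+x<ackermann i 1 ⟩
    ackermann i 1   ∎
    where open ≤-Reasoning
  i+x<ackermann (suc i) (suc x) = begin-strict
    suc i + suc x                        ≤⟨ ≤-reflexive (cong suc (+-suc i x)) ⟩
    suc (suc i + x)                      ≤⟨ i+x<ackermann (suc i) x ⟩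
    ackermann (suc i) x                  ≤⟨ m≤n+m _ i ⟩
    i + ackermann (suc i) x              <⟨ i+x<ackermann i _ ⟩
    ackermann i (ackermann (suc i) x)    ∎
    where open ≤-Reasoning

least : ∀ {P : ℕ → Set} → Decidable P → ∀ b → P b →
        ∃ λ i → P i × (∀ {j} → j < i → ¬ P j)
least P? zero    p = zero , p , λ ()
least P? (suc b) p with P? zero
... | yes p₀ = zero , p₀ , λ ()
... | no ¬p₀ with least (P? ∘ suc) b p
...   | i , pᵢ , min = suc i , pᵢ ,
        λ { {zero} _ → ¬p₀ ; {suc j} (s≤s j<i) → min j<i }

private
  n≤2^n : ∀ n → n ≤ 2 ^ n
  n≤2^n zero    = z≤n
  n≤2^n (suc n) = +-mono-≤ (m^n>0 2 n) (≤-trans (n≤2^n n) (m≤m+n _ 0))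

  ⌈log₂n⌉≤n : ∀ n → ⌈log₂ n ⌉ ≤ n
  ⌈log₂n⌉≤n n = subst (⌈log₂ n ⌉ ≤_) (⌈log₂2^n⌉≡n n) (⌈log₂⌉-mono-≤ (n≤2^n n))

  ackermann-large : ∀ n x → ⌈log₂ n ⌉ ≤ ackermann (suc n) x
  ackermann-large n x = begin
    ⌈log₂ n ⌉           ≤⟨ ⌈log₂n⌉≤n n ⟩
    n                   ≤⟨ n≤1+n n ⟩
    suc n               ≤⟨ m≤m+n (suc n) x ⟩
    suc n + x           <⟨ i+x<ackermann (suc n) x ⟩
    ackermann (suc n) x ∎
    where open ≤-Reasoning

-- α m n = min { i ≥ 1 | A (i , ⌊ m / n ⌋) ≥ log₂ n }; the search is over
-- i - 1, and rounding log₂ n up does not change the comparison.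
α : (m n : ℕ) .{{_ : NonZero n}} → ℕ
α m n = suc (proj₁ (least
  (λ i → ⌈log₂ n ⌉ ≤? ackermann (suc i) (m / n)) n (ackermann-large n (m / n))))

⌈_/_⌉ : (n k : ℕ) .{{_ : NonZero k}} → ℕ
⌈ n / k ⌉ = (n + pred k) / k

------------------------------------------------------------------------
-- Local computation: a deterministic structured word-RAM language.
--
-- All state is kept in the memory; there are no further registers.  A machine
-- of capacity S has the cells with addresses below S, each holding a number
-- below S (a word of ⌈log₂ S⌉ bits).  Execution is stuck when a program
-- addresses a cell or produces a value that does not fit, so a completed
-- execution respects the capacity at all times.

Memory : Set
Memory = ℕ → ℕ

_[_↦_] : Memory → ℕ → ℕ → Memory
(M [ a ↦ x ]) b = if b ≡ᵇ a then x else M b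

data Op : Set where
  plus monus times : Op

⟦_⟧ : Op → ℕ → ℕ → ℕ
⟦ plus  ⟧ = _+_
⟦ monus ⟧ = _∸_
⟦ times ⟧ = _*_

data Expr : Set where
  lit : ℕ → Expr
  !_  : Expr → Expr                -- contents of the cell with this address
  bin : Op → Expr → Expr → Expr

data Cmd : Set where
  skip   : Cmd
  _≔_    : Expr → Expr → Cmd       -- address ≔ value
  _⨾_    : Cmd → Cmd → Cmd
  cond   : Expr → Cmd → Cmd → Cmd  -- a nonzero test counts as true
  while  : Expr → Cmd → Cmd

infix  6 _≔_
infixr 5 _⨾_

-- Unit cost per operation.
cost : Expr → ℕ
cost (lit _)     = 1
cost (! e)       = suc (cost e)
cost (bin _ d e) = suc (cost d + cost e)

module Machine (S : ℕ) where

  data _⊢_⇓_ (M : Memory) : Expr → ℕ → Set where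
    lit  : ∀ {x} → x < S → M ⊢ lit x ⇓ x
    load : ∀ {e a} → M ⊢ e ⇓ a → M a < S → M ⊢ ! e ⇓ M a
    bin  : ∀ {o d e x y} → M ⊢ d ⇓ x → M ⊢ e ⇓ y → ⟦ o ⟧ x y < S →
           M ⊢ bin o d e ⇓ ⟦ o ⟧ x y

  -- ⟨ P , M ⟩⇓[ t ] M′ : started in M, P halts in M′ after time t.
  data ⟨_,_⟩⇓[_]_ : Cmd → Memory → ℕ → Memory → Set where
    skip    : ∀ {M} → ⟨ skip , M ⟩⇓[ 1 ] M
    assign  : ∀ {M d e a x} → M ⊢ d ⇓ a → M ⊢ e ⇓ x →
              ⟨ d ≔ e , M ⟩⇓[ suc (cost d + cost e) ] (M [ a ↦ x ])
    seq     : ∀ {M M′ M″ P Q s t} →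
              ⟨ P , M ⟩⇓[ s ] M′ → ⟨ Q , M′ ⟩⇓[ t ] M″ →
              ⟨ P ⨾ Q , M ⟩⇓[ s + t ] M″
    cond-t  : ∀ {M M′ e x P Q t} → M ⊢ e ⇓ x → x ≢ 0 →
              ⟨ P , M ⟩⇓[ t ] M′ →
              ⟨ cond e P Q , M ⟩⇓[ suc (cost e + t) ] M′
    cond-f  : ∀ {M M′ e P Q t} → M ⊢ e ⇓ 0 →
              ⟨ Q , M ⟩⇓[ t ] M′ →
              ⟨ cond e P Q , M ⟩⇓[ suc (cost e + t) ] M′
    while-t : ∀ {M M′ M″ e x P s t} → M ⊢ e ⇓ x → x ≢ 0 →
              ⟨ P , M ⟩⇓[ s ] M′ → ⟨ while e P , M′ ⟩⇓[ t ] M″ →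
              ⟨ while e P , M ⟩⇓[ suc (cost e + (s + t)) ] M″
    while-f : ∀ {M e P} → M ⊢ e ⇓ 0 →
              ⟨ while e P , M ⟩⇓[ suc (cost e) ] M

------------------------------------------------------------------------
-- Multi-pass streaming algorithms

record StreamingAlgorithm : Set where
  field
    start   : Cmd   -- run once, before the first pass
    onEdge  : Cmd   -- run after each edge that is read
    endPass : Cmd   -- run at the end of each pass

-- Memory layout shared with the environment: n, k, the two endpoints of the
-- edge just read, a flag that is nonzero when no further pass is wanted, and
-- the first of the n consecutive cells that finally hold the parents of the
-- vertices 0, …, n - 1.
nCell kCell uCell vCell doneCell outCell : ℕ
nCell    = 0
kCell    = 1
uCell    = 2
vCell    = 3
doneCell = 4
outCell  = 5

initial : ℕ → ℕ → Memory
initial n k = ((λ _ → 0) [ nCell ↦ n ]) [ kCell ↦ k ]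

receive : ∀ {n} → Edge n → Memory → Memory
receive (u , v) M = (M [ uCell ↦ toℕ u ]) [ vCell ↦ toℕ v ]

-- Each edge occurs exactly once, in any order and with its endpoints listed in
-- either order.
Presents : ∀ {n} → List (Edge n) → Graph n → Set
Presents es G = Permutation SameEdge es (edges G)

module Execution (S : ℕ) (A : StreamingAlgorithm) where
  open Machine S
  open StreamingAlgorithm A

  -- Reading an edge takes one time unit.
  data ReadAll {n} : List (Edge n) → Memory → ℕ → Memory → Set where
    []  : ∀ {M} → ReadAll [] M 0 M
    _∷_ : ∀ {e es M M′ M″ s t} →
          ⟨ onEdge , receive e M ⟩⇓[ s ] M′ → ReadAll es M′ t M″ →
          ReadAll (e ∷ es) M (suc (s + t)) M″

  data Pass {n} (es : List (Edge n)) (M : Memory) : ℕ → Memory → Set where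
    pass : ∀ {M′ M″ s t} →
           ReadAll es M s M′ → ⟨ endPass , M′ ⟩⇓[ t ] M″ →
           Pass es M (s + t) M″

  -- Passes stream i M ts M′ : from M, just before pass number i, the passes
  -- still made take the times ts and the algorithm stops in M′.
  data Passes {n} (stream : ℕ → List (Edge n)) :
              ℕ → Memory → List ℕ → Memory → Set where
    stop : ∀ {i M} → M doneCell ≢ 0 → Passes stream i M [] M
    next : ∀ {i M M′ M″ t ts} → M doneCell ≡ 0 →
           Pass (stream i) M t M′ → Passes stream (suc i) M′ ts M″ →
           Passes stream i M (t ∷ ts) M″

  -- The shared cells must lie within the capacity.  The list holds the times of
  -- the individual passes; the first time is that of the preprocessing.
  data Run {n} (k : ℕ) (stream : ℕ → List (Edge n)) :
           ℕ → List ℕ → Memory → Set where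
    run : ∀ {M M′ t₀ ts} → outCell + n ≤ S →
          ⟨ start , initial n k ⟩⇓[ t₀ ] M → Passes stream 0 M ts M′ →
          Run k stream t₀ ts M′

open Execution public using (Run)

Outputs : ∀ {n} → Memory → (Fin n → Fin n) → Set
Outputs M parent = ∀ v → M (outCell + toℕ v) ≡ toℕ (parent v)

{-# OPTIONS --safe #-}
-- One pass suffices to extend a depth-first search by k vertices.  During the
-- pass every vertex stores up to k arcs to vertices still unvisited.  The search
-- is then resumed from the current vertex, using the stored arcs only, until k
-- new vertices have been visited.  A vertex that runs out of stored arcs before
-- that has stored fewer than k of them, since k stored arcs would lead to k
-- vertices visited in this pass; hence it stored all of them and the search may
-- retreat from it.  As the root counts before the first pass, a search not
-- finished after j passes has visited 1 + jk ≤ n vertices, so that there are at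
-- most 1 + ⌊(n - 1)/k⌋ = ⌈n/k⌉ passes.
--
-- No union-find structure is needed.  The search stack is the path of parents
-- from the current vertex, and a pass takes time O(m + n): the quantity
-- 2 · (stored arcs) + (stack height) decreases at each step of the search, and
-- n ≤ 2 max(m, 1) in a connected graph.
module Submission where

open import Data.Bool.Base using (true; false; T)
open import Data.Empty using (⊥)
open import Data.Fin.Base using (Fin; zero; suc; toℕ; fromℕ<)
open import Data.Fin.Properties
  using (_≟_; injective⇒≤; toℕ<n; toℕ-fromℕ<; toℕ-injective; toℕ-↑ˡ; toℕ-↑ʳ; toℕ-combine; +↔⊎; *↔×)
open import Data.List.Base using (List; []; _∷_; length; lookup; map; allFin; _++_)
import Data.List.Membership.DecPropositional as DecMembership
open import Data.List.Membership.Propositional using (_∈_; _∉_)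
open import Data.List.Membership.Propositional.Properties
  using (∈-lookup; ∈-allFin; ∈-map⁺; ∈-map⁻; ∈-++⁻; ∈-++⁺ʳ)
open import Data.List.Membership.Setoid.Properties using (index-injective)
open import Data.List.Properties using (length-map; length-tabulate; map-++; length-++)
import Data.List.Relation.Binary.Permutation.Setoid as Permutation
import Data.List.Relation.Binary.Permutation.Setoid.Properties as PermutationProperties
open import Data.List.Relation.Binary.Subset.Propositional using (_⊆_)
open import Data.List.Relation.Unary.All as All using (All; []; _∷_)
open import Data.List.Relation.Unary.All.Properties using (¬Any⇒All¬)
open import Data.List.Relation.Unary.AllPairs using (AllPairs; []; _∷_)
open import Data.List.Relation.Unary.Any as Any using (Any; here; there)
open import Data.List.Relation.Unary.Unique.Propositional using (Unique)
open import Data.List.Relation.Unary.Unique.Propositional.Properties using (allFin⁺)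
open import Data.Nat.Base hiding (_!)
open import Data.Nat.DivMod using (_/_; _%_; m≡m%n+[m/n]*n; m%n<n)
open import Data.Nat.Properties hiding (_≟_)
open import Data.Nat.Tactic.RingSolver using (solve-∀)
open import Data.Product.Base using (Σ-syntax; ∃; ∃-syntax; _×_; _,_; proj₁; proj₂; swap)
open import Data.Sum.Base using (_⊎_; inj₁; inj₂)
open import Data.Sum.Function.Propositional using (_⊎-↔_)
open import Data.Unit.Base using (⊤; tt)
open import Data.Vec.Functional using (Vector; updateAt; head; tail)
open import Data.Vec.Functional.Properties using (updateAt-updates; updateAt-minimal)
open import Function.Base using (_∘_; const; case_of_)
open import Function.Bundles using (_↔_; Inverse; Injection)
open import Function.Construct.Composition using (_↔-∘_)
open import Function.Construct.Identity using (↔-id)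
open import Function.Properties.Inverse using (↔-sym; Inverse⇒Injection)
open import Relation.Binary.Bundles using (Setoid)
open import Relation.Binary.Construct.Closure.ReflexiveTransitive as Star using (Star; ε; _◅_)
open import Relation.Binary.PropositionalEquality
open import Relation.Nullary using (¬_; yes; no; contradiction)
open import Defs

-- Duplicate-free lists and families of lists indexed by vertices

lookup-injective : {A : Set} {xs : List A} → Unique xs →
                   ∀ {i j} → lookup xs i ≡ lookup xs j → i ≡ j
lookup-injective (x∉xs ∷ u) {zero}  {zero}  eq = refl
lookup-injective (x∉xs ∷ u) {zero}  {suc j} eq =
  contradiction eq (All.lookup x∉xs (∈-lookup j))
lookup-injective (x∉xs ∷ u) {suc i} {zero}  eq =
  contradiction (sym eq) (All.lookup x∉xs (∈-lookup i))
lookup-injective (x∉xs ∷ u) {suc i} {suc j} eq = cong suc (lookup-injective u eq)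

-- Pigeonhole: sending each position of `xs` to a position of the same element in `ys` is injective.
unique⊆⇒length≤ : {A : Set} {xs ys : List A} → Unique xs → xs ⊆ ys →
                  length xs ≤ length ys
unique⊆⇒length≤ u xs⊆ys = injective⇒≤
  {f = λ i → Any.index (xs⊆ys (∈-lookup i))}
  (λ eq → lookup-injective u (index-injective (setoid _) (xs⊆ys (∈-lookup _)) (xs⊆ys (∈-lookup _)) eq))

unique⇒length≤n : ∀ {n} {xs : List (Fin n)} → Unique xs → length xs ≤ n
unique⇒length≤n {n} {xs} u =
  subst (length xs ≤_) (length-tabulate {n = n} (λ i → i))
        (unique⊆⇒length≤ u (λ {x} _ → ∈-allFin x))

updateAt-elim : {A : Set} {n : ℕ} (P : Fin n → A → Set) {xs : Vector A n}
                {i : Fin n} {f : A → A} → P i (f (xs i)) →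
                (∀ j → j ≢ i → P j (xs j)) → ∀ j → P j (updateAt xs i f j)
updateAt-elim P {xs} {i} pᵢ pⱼ j with j ≟ i
... | yes refl = subst (P i) (sym (updateAt-updates i xs)) pᵢ
... | no  j≢i  = subst (P j) (sym (updateAt-minimal j i xs j≢i)) (pⱼ j j≢i)

total : {A : Set} {n : ℕ} → Vector (List A) n → ℕ
total {n = zero}  L = 0
total {n = suc n} L = length (head L) + total (tail L)

-- The old length is added on the left rather than subtracted on the right, so that growing a list
-- and shrinking one are both instances without truncated subtraction.
total-updateAt : {A : Set} {n : ℕ} (L : Vector (List A) n) (i : Fin n) (f : List A → List A) →
                 total (updateAt L i f) + length (L i) ≡ total L + length (f (L i))
total-updateAt L zero f = exchange (length (f (head L))) (total (tail L)) (length (head L))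
  where
  exchange : ∀ a b c → a + b + c ≡ c + b + a
  exchange = solve-∀
total-updateAt L (suc i) f = begin
  length (head L) + total (updateAt (tail L) i f) + length (L (suc i))   ≡⟨ +-assoc (length (head L)) _ _ ⟩
  length (head L) + (total (updateAt (tail L) i f) + length (L (suc i))) ≡⟨ cong (length (head L) +_) (total-updateAt (tail L) i f) ⟩
  length (head L) + (total (tail L) + length (f (L (suc i))))            ≡⟨ +-assoc (length (head L)) _ _ ⟨
  length (head L) + total (tail L) + length (f (L (suc i)))              ∎
  where open ≡-Reasoning

-- Edges up to orientation, streams and arcs

sameEdge-sym : ∀ {n} {e f : Edge n} → SameEdge e f → SameEdge f e
sameEdge-sym (inj₁ refl) = inj₁ refl
sameEdge-sym (inj₂ refl) = inj₂ refl

sameEdge-trans : ∀ {n} {e f g : Edge n} → SameEdge e f → SameEdge f g → SameEdge e g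
sameEdge-trans (inj₁ refl) s           = s
sameEdge-trans (inj₂ refl) (inj₁ refl) = inj₂ refl
sameEdge-trans (inj₂ refl) (inj₂ refl) = inj₁ refl

sameEdge-swap : ∀ {n} {e f : Edge n} → SameEdge e f → SameEdge (swap e) f
sameEdge-swap (inj₁ refl) = inj₂ refl
sameEdge-swap (inj₂ refl) = inj₁ refl

edgeSetoid : ℕ → Setoid _ _
edgeSetoid n = record
  { Carrier = Edge n
  ; _≈_ = SameEdge
  ; isEquivalence = record { refl = inj₁ refl ; sym = sameEdge-sym ; trans = sameEdge-trans }
  }

-- These facts are all that the passes use of the stream; each survives reordering the edges and
-- reversing some of them.
record SimpleStream {n} (G : Graph n) (es : List (Edge n)) : Set where
  field
    adj⇒∈    : ∀ {u v} → Adj G u v → Any (SameEdge (u , v)) es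
    ∈⇒adj    : ∀ {u v} → Any (SameEdge (u , v)) es → Adj G u v
    no-loops : All (λ e → proj₁ e ≢ proj₂ e) es
    distinct : AllPairs (λ e f → ¬ SameEdge e f) es
    length≡  : length es ≡ size G

presents⇒simple : ∀ {n} {G : Graph n} {es} → Presents es G → SimpleStream G es
presents⇒simple {n} {G} {es} es↭ = record
  { adj⇒∈    = Any-resp-↭ (λ e≈f s → sameEdge-trans s e≈f) (↭-sym es↭)
  ; ∈⇒adj    = Any-resp-↭ (λ e≈f s → sameEdge-trans s e≈f) es↭
  ; no-loops = All-resp-↭ (λ { (inj₁ refl) u≢v → u≢v ; (inj₂ refl) u≢v → u≢v ∘ sym })
                          (↭-sym es↭) (loopless G)
  ; distinct = AllPairs-resp-↭ (λ ¬s s → ¬s (sameEdge-sym s))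
                 ( (λ e≈f ¬s s → ¬s (sameEdge-trans s (sameEdge-sym e≈f)))
                 , (λ e≈f ¬s s → ¬s (sameEdge-trans e≈f s)) )
                 (↭-sym es↭) (simple G)
  ; length≡  = xs↭ys⇒|xs|≡|ys| es↭
  }
  where
  open PermutationProperties (edgeSetoid n)
  open Permutation (edgeSetoid n) using (↭-sym)

-- The accumulator holds the arcs of the edges already read, the latest first: an edge `e` offers
-- the arc `e` and then `swap e`.
arcs : ∀ {n} → List (Edge n) → List (Edge n) → List (Edge n)
arcs []       as = as
arcs (e ∷ es) as = arcs es (swap e ∷ e ∷ as)

length-arcs : ∀ {n} (es as : List (Edge n)) → length (arcs es as) ≡ 2 * length es + length as
length-arcs []       as = refl
length-arcs (e ∷ es) as = trans (length-arcs es _) (shift (length es) (length as))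
  where
  shift : ∀ a b → 2 * a + suc (suc b) ≡ 2 * suc a + b
  shift = solve-∀

∈-arcs⁻ : ∀ {n} {x : Edge n} es {as} → x ∈ arcs es as → Any (SameEdge x) es ⊎ x ∈ as
∈-arcs⁻ []       x∈ = inj₂ x∈
∈-arcs⁻ (e ∷ es) x∈ with ∈-arcs⁻ es x∈
... | inj₁ x≈                      = inj₁ (there x≈)
... | inj₂ (here refl)             = inj₁ (here (inj₂ refl))
... | inj₂ (there (here refl))     = inj₁ (here (inj₁ refl))
... | inj₂ (there (there x∈as))    = inj₂ x∈as

∈-arcs⁺ : ∀ {n} {x : Edge n} es {as} → Any (SameEdge x) es ⊎ x ∈ as → x ∈ arcs es as
∈-arcs⁺ []       (inj₂ x∈as)               = x∈as
∈-arcs⁺ (e ∷ es) (inj₁ (here (inj₁ refl))) = ∈-arcs⁺ es (inj₂ (there (here refl)))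
∈-arcs⁺ (e ∷ es) (inj₁ (here (inj₂ refl))) = ∈-arcs⁺ es (inj₂ (here refl))
∈-arcs⁺ (e ∷ es) (inj₁ (there x≈))         = ∈-arcs⁺ es (inj₁ x≈)
∈-arcs⁺ (e ∷ es) (inj₂ x∈as)               = ∈-arcs⁺ es (inj₂ (there (there x∈as)))

adj-sym : ∀ {n} (G : Graph n) {u v} → Adj G u v → Adj G v u
adj-sym G = Any.map sameEdge-swap

-- With at least two vertices every vertex has a neighbour, so it is the tail of one of the 2m arcs.
-- A single vertex has no edge, whence the maximum with 1.
connected⇒n≤2m : ∀ {n} (G : Graph n) → Connected G → n ≤ 2 * (size G ⊔ 1)
connected⇒n≤2m {zero}        G conn = z≤n
connected⇒n≤2m {suc zero}    G conn =
  *-mono-≤ {1} {2} (s≤s z≤n) (m≤n⊔m (size G) 1)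
connected⇒n≤2m {n@(suc (suc _))} G conn = begin
  n                        ≡⟨ length-tabulate {n = n} (λ i → i) ⟨
  length (allFin n)        ≤⟨ unique⊆⇒length≤ (allFin⁺ n) (λ {v} _ → endpoint v) ⟩
  length endpoints         ≡⟨ length-map proj₁ (arcs (edges G) []) ⟩
  length (arcs (edges G) []) ≡⟨ length-arcs (edges G) [] ⟩
  2 * size G + 0           ≡⟨ +-identityʳ _ ⟩
  2 * size G               ≤⟨ *-monoʳ-≤ 2 (m≤m⊔n (size G) 1) ⟩
  2 * (size G ⊔ 1)         ∎
  where
  open ≤-Reasoning
  endpoints = map proj₁ (arcs (edges G) [])
  neighbour : ∀ {u v} → u ≢ v → Star (Adj G) u v → ∃ (Adj G u)
  neighbour u≢v ε       = contradiction refl u≢v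
  neighbour u≢v (a ◅ _) = _ , a
  other : (v : Fin n) → ∃ λ u → v ≢ u
  other zero    = suc zero , λ ()
  other (suc v) = zero , λ ()
  endpoint : ∀ v → v ∈ endpoints
  endpoint v with other v
  ... | u , v≢u = ∈-map⁺ proj₁ (∈-arcs⁺ (edges G) (inj₁ (proj₂ (neighbour v≢u (conn v u)))))

-- Partial depth-first search trees

visited : ∀ {n} → List (Edge n) → List (Fin n)
visited = map proj₁

module DepthFirst {n : ℕ} (G : Graph n) (root : Fin n) where

  -- A partial tree is the list of its pairs (vertex , parent), so that ancestry
  -- is monotone in the tree.
  Anc : List (Edge n) → Fin n → Fin n → Set
  Anc T u v = Star (λ x y → (x , y) ∈ T) v u

  -- The list is the chain of parents above the current vertex, nearest first. The current vertex is
  -- kept apart because it alone occupies a memory cell.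
  data Stack (T : List (Edge n)) : Fin n → List (Fin n) → Set where
    bottom : Stack T root []
    push   : ∀ {x y s} → (x , y) ∈ T → x ≢ root → Stack T y s → Stack T x (y ∷ s)

  Closed : List (Edge n) → Fin n → Set
  Closed T u = ∀ w → Adj G u w → w ∈ visited T

  -- `open⊎closed` is the depth-first invariant: only vertices on the stack can still have unvisited
  -- neighbours. It keeps `comparable` true when a vertex is added. `depth` bounds the stack height
  -- for the time analysis.
  record Search (T : List (Edge n)) (c : Fin n) (s : List (Fin n)) : Set where
    field
      unique     : Unique (visited T)
      root∈      : (root , root) ∈ T
      edge       : ∀ {x y} → (x , y) ∈ T → x ≢ root → Adj G x y
      reach      : ∀ {v} → v ∈ visited T → Anc T root v
      comparable : ∀ {u v} → u ∈ visited T → v ∈ visited T → Adj G u v → Anc T u v ⊎ Anc T v u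
      stack      : Stack T c s
      open⊎closed : ∀ {u} → u ∈ visited T → u ∈ c ∷ s ⊎ Closed T u
      depth      : suc (length s) ≤ length T

  open Search

  top∈ : ∀ {T c s} → Search T c s → c ∈ visited T
  top∈ S with stack S
  ... | bottom      = ∈-map⁺ proj₁ (root∈ S)
  ... | push xy _ _ = ∈-map⁺ proj₁ xy

  stack-mono : ∀ {T c s e} → Stack T c s → Stack (e ∷ T) c s
  stack-mono bottom        = bottom
  stack-mono (push xy x≢ s) = push (there xy) x≢ (stack-mono s)

  stack⇒ancestor : ∀ {T c s u} → Stack T c s → u ∈ c ∷ s → Anc T u c
  stack⇒ancestor _             (here refl) = ε
  stack⇒ancestor (push xy _ s) (there u∈)  = xy ◅ stack⇒ancestor s u∈

  search-start : Search ((root , root) ∷ []) root []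
  search-start = record
    { unique      = [] ∷ []
    ; root∈       = here refl
    ; edge        = λ { (here refl) x≢ → contradiction refl x≢ }
    ; reach       = λ { (here refl) → ε }
    ; comparable  = λ { (here refl) (here refl) _ → inj₁ ε }
    ; stack       = bottom
    ; open⊎closed = λ { (here refl) → inj₁ (here refl) }
    ; depth       = s≤s z≤n
    }

  search-visit : ∀ {T c s w} → w ∉ visited T → Adj G c w → Search T c s →
                 Search ((w , c) ∷ T) w (c ∷ s)
  search-visit {T} {c} {s} {w} w∉ c~w S = record
    { unique      = ¬Any⇒All¬ _ w∉ ∷ unique S
    ; root∈       = there (root∈ S)
    ; edge        = λ { (here refl) _ → adj-sym G c~w ; (there xy) → edge S xy }
    ; reach       = λ { (here refl) → here refl ◅ mono (reach S (top∈ S))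
                      ; (there v∈) → mono (reach S v∈) }
    ; comparable  = λ { (here refl) (here refl) _ → inj₁ ε
                      ; (here refl) (there v∈) w~v → inj₂ (above v∈ (adj-sym G w~v))
                      ; (there u∈) (here refl) u~w → inj₁ (above u∈ u~w)
                      ; (there u∈) (there v∈) u~v → case comparable S u∈ v∈ u~v of λ
                          { (inj₁ a) → inj₁ (mono a) ; (inj₂ a) → inj₂ (mono a) } }
    ; stack       = push (here refl) w≢root (stack-mono (stack S))
    ; open⊎closed = λ { (here refl) → inj₁ (here refl)
                      ; (there u∈) → case open⊎closed S u∈ of λ
                          { (inj₁ u∈s) → inj₁ (there u∈s)
                          ; (inj₂ cl) → inj₂ (λ v u~v → there (cl v u~v)) } }
    ; depth       = s≤s (depth S)
    }
    where
    mono : ∀ {u v} → Anc T u v → Anc ((w , c) ∷ T) u v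
    mono = Star.map there
    w≢root : w ≢ root
    w≢root refl = w∉ (∈-map⁺ proj₁ (root∈ S))
    -- A visited neighbour of the unvisited w is not closed, hence on the stack.
    above : ∀ {u} → u ∈ visited T → Adj G u w → Anc ((w , c) ∷ T) u w
    above u∈ u~w with open⊎closed S u∈
    ... | inj₁ u∈s = here refl ◅ mono (stack⇒ancestor (stack S) u∈s)
    ... | inj₂ cl  = contradiction (cl w u~w) w∉

  search-retreat : ∀ {T c y s} → Closed T c → Search T c (y ∷ s) → Search T y s
  search-retreat {T} {c} {y} {s} cl S = record
    { unique = unique S ; root∈ = root∈ S ; edge = edge S ; reach = reach S
    ; comparable = comparable S
    ; stack = case stack S of λ { (push _ _ st) → st }
    ; open⊎closed = λ u∈ → case open⊎closed S u∈ of λ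
        { (inj₁ (here refl)) → inj₂ cl
        ; (inj₁ (there u∈s)) → inj₁ u∈s
        ; (inj₂ cl′)         → inj₂ cl′ }
    ; depth = ≤-trans (n≤1+n _) (depth S)
    }

  -- Once a single closed vertex is left on the stack, all visited vertices are closed, so being
  -- visited spreads along every path.
  search-finish : ∀ {T c} → Connected G → Closed T c → Search T c [] → ∀ v → v ∈ visited T
  search-finish {T} conn cl S v = along (top∈ S) (conn _ v)
    where
    closed : ∀ {u} → u ∈ visited T → Closed T u
    closed u∈ with open⊎closed S u∈
    ... | inj₁ (here refl) = cl
    ... | inj₂ cl′         = cl′
    along : ∀ {u v} → u ∈ visited T → Star (Adj G) u v → v ∈ visited T
    along u∈ ε          = u∈
    along u∈ (u~w ◅ ws) = along (closed u∈ _ u~w) ws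

  search⇒DFSTree : ∀ {T c s} {parent : Fin n → Fin n} → Search T c s →
                   (∀ v → v ∈ visited T) →
                   (∀ {x y} → (x , y) ∈ T → parent x ≡ y) → IsDFSTree G root parent
  search⇒DFSTree {T} {parent = parent} S all p≡ = record
    { isRootedSpanningTree = record
      { parent-root = p≡ (root∈ S)
      ; parent-adj  = parent-adj
      ; reaches     = λ v → mono (reach S (all v))
      }
    ; nonTree⇒back = λ u v u~v _ → case comparable S (all u) (all v) u~v of λ
        { (inj₁ a) → inj₁ (mono a) ; (inj₂ a) → inj₂ (mono a) }
    }
    where
    mono : ∀ {u v} → Anc T u v → Ancestor parent u v
    mono = Star.map p≡
    parent-adj : ∀ v → v ≢ root → Adj G v (parent v)
    parent-adj v v≢ with ∈-map⁻ proj₁ (all v)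
    ... | (_ , y) , vy , refl = subst (Adj G v) (sym (p≡ vy)) (edge S vy v≢)

-- The arcs stored while a pass is read

module Collecting {n : ℕ} (k : ℕ) (V : List (Fin n)) where

  -- `V` consists of the vertices visited before the pass and `as` of the arcs offered so far. A
  -- list that is not full has lost no arc to an unvisited vertex; nothing of the kind is claimed of
  -- a full one.
  record Collected (as : List (Edge n)) (v : Fin n) (l : List (Fin n)) : Set where
    field
      bounded  : length l ≤ k
      sound    : ∀ {w} → w ∈ l → w ∉ V × (v , w) ∈ as
      unique   : Unique l
      complete : length l < k → ∀ {w} → w ∉ V → (v , w) ∈ as → w ∈ l

  -- `total≤` makes the search after the reading linear in the number of edges; `bounded` alone
  -- would give only n times k.
  record CollectedAll (as : List (Edge n)) (L : Vector (List (Fin n)) n) : Set where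
    field
      collected : ∀ v → Collected as v (L v)
      total≤    : total L ≤ length as

  open Collected
  open CollectedAll

  -- The single hypothesis covers the three reasons for leaving a list unchanged: it is full, the
  -- head of the arc is already visited, or the arc starts at another vertex.
  collected-skip : ∀ {as a b v l} → (length l < k → b ∉ V → v ≢ a) →
                   Collected as v l → Collected ((a , b) ∷ as) v l
  collected-skip h C = record
    { bounded  = bounded C
    ; sound    = λ w∈ → proj₁ (sound C w∈) , there (proj₂ (sound C w∈))
    ; unique   = unique C
    ; complete = λ { l<k w∉ (here refl) → contradiction refl (h l<k w∉)
                   ; l<k w∉ (there vw∈) → complete C l<k w∉ vw∈ }
    }

  collected-store : ∀ {as a b l} → b ∉ V → length l < k → (a , b) ∉ as →
                    Collected as a l → Collected ((a , b) ∷ as) a (b ∷ l)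
  collected-store b∉ l<k ab∉ C = record
    { bounded  = l<k
    ; sound    = λ { (here refl) → b∉ , here refl
                   ; (there w∈) → proj₁ (sound C w∈) , there (proj₂ (sound C w∈)) }
    ; unique   = ¬Any⇒All¬ _ (λ b∈l → ab∉ (proj₂ (sound C b∈l))) ∷ unique C
    ; complete = λ { _ w∉ (here refl) → here refl
                   ; _ w∉ (there vw∈) → there (complete C l<k w∉ vw∈) }
    }

  collect-none : ∀ {L} → (∀ v → L v ≡ []) → total L ≡ 0 → CollectedAll [] L
  collect-none {L} L≡[] t≡0 = record
    { collected = λ v → subst (Collected [] v) (sym (L≡[] v)) record
        { bounded = z≤n ; sound = λ () ; unique = [] ; complete = λ _ _ () }
    ; total≤ = ≤-reflexive t≡0
    }

  collect-skip : ∀ {as a b L} → (length (L a) < k → b ∈ V) →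
                 CollectedAll as L → CollectedAll ((a , b) ∷ as) L
  collect-skip h C = record
    { collected = λ v → collected-skip (λ { l<k b∉ refl → b∉ (h l<k) }) (collected C v)
    ; total≤ = m≤n⇒m≤1+n (total≤ C)
    }

  collect-store : ∀ {as a b L} → b ∉ V → length (L a) < k → (a , b) ∉ as →
                  CollectedAll as L → CollectedAll ((a , b) ∷ as) (updateAt L a (b ∷_))
  collect-store {as} {a} {b} {L} b∉ l<k ab∉ C = record
    { collected = updateAt-elim (Collected ((a , b) ∷ as))
        (collected-store b∉ l<k ab∉ (collected C a))
        (λ v v≢a → collected-skip (λ _ _ → v≢a) (collected C v))
    ; total≤ = +-cancelʳ-≤ (length (L a)) _ _ (begin
        total (updateAt L a (b ∷_)) + length (L a) ≡⟨ total-updateAt L a (b ∷_) ⟩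
        total L + suc (length (L a))               ≤⟨ +-monoˡ-≤ _ (total≤ C) ⟩
        length as + suc (length (L a))             ≡⟨ +-suc (length as) _ ⟩
        suc (length as) + length (L a)             ∎)
    }
    where open ≤-Reasoning

-- The program and its verification rules

infixl 7 _⊕_ _⊖_
infixl 8 _⊗_

_⊕_ _⊖_ _⊗_ : Expr → Expr → Expr
_⊕_ = bin plus
_⊖_ = bin monus
_⊗_ = bin times

n̂ k̂ û v̂ top : Expr
n̂ = ! lit nCell
k̂ = ! lit kCell
û = ! lit uCell
v̂ = ! lit vCell
top = lit outCell ⊕ n̂

-- The regions from `outCell` on are, in order: n parents, one cell for the current vertex, n marks,
-- n counts of stored arcs, and k slots for each vertex.
par[_] vis[_] deg[_] : Expr → Expr
par[ e ] = lit outCell ⊕ e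
vis[ e ] = lit outCell ⊕ (n̂ ⊕ (lit 1 ⊕ e))
deg[ e ] = vis[ n̂ ⊕ e ]

adj[_,_] : Expr → Expr → Expr
adj[ e , i ] = deg[ n̂ ⊕ (k̂ ⊗ e ⊕ i) ]

offer : Expr → Expr → Cmd
offer x y =
  cond (! vis[ y ]) skip
    -- Truncated subtraction serves as the comparison: the value is nonzero exactly if fewer than k
    -- arcs are stored.
    (cond (k̂ ⊖ ! deg[ x ])
      (adj[ x , ! deg[ x ] ] ≔ y ⨾ deg[ x ] ≔ lit 1 ⊕ ! deg[ x ])
      skip)

-- After the edges have been read, the endpoint cells are free for other use. `uCell` counts the
-- vertices that the pass may still visit, and later those whose lists are still to be cleared;
-- `vCell` holds the head of the arc taken from a list.
descend scan retreat advance clear : Cmd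
descend =
  vis[ v̂ ] ≔ lit 1 ⨾
  par[ v̂ ] ≔ ! top ⨾
  top ≔ v̂ ⨾
  lit uCell ≔ û ⊖ lit 1
scan =
  deg[ ! top ] ≔ ! deg[ ! top ] ⊖ lit 1 ⨾
  lit vCell ≔ ! adj[ ! top , ! deg[ ! top ] ] ⨾
  cond (! vis[ v̂ ]) skip descend
retreat =
  -- The root is vertex 0, so a nonzero current vertex has a parent to return to.
  cond (! top)
    (top ≔ ! par[ ! top ])
    (lit doneCell ≔ lit 1 ⨾ lit uCell ≔ lit 0)
advance = cond (! deg[ ! top ]) scan retreat
clear = lit uCell ≔ û ⊖ lit 1 ⨾ deg[ û ] ≔ lit 0

dfs : StreamingAlgorithm
dfs = record
  -- Memory is zero apart from n and k, so vertex 0 is already the current vertex and its own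
  -- parent; only its mark is missing.
  { start   = vis[ lit 0 ] ≔ lit 1
  ; onEdge  = offer û v̂ ⨾ offer v̂ û
  ; endPass = lit uCell ≔ k̂ ⨾ while û advance ⨾ lit uCell ≔ n̂ ⨾ while û clear
  }

-- Opaque, so that time bounds stay symbolic.
opaque
  steps : Cmd → ℕ
  steps skip         = 1
  steps (d ≔ e)      = suc (cost d + cost e)
  steps (P ⨾ Q)      = steps P + steps Q
  steps (cond e P Q) = suc (cost e + (steps P + steps Q))
  -- A dummy value: `wp` is empty on loops, whose time is bounded by `iterations`.
  steps (while e P)  = 0

iterations : Expr → Cmd → ℕ → ℕ
iterations e P μ = suc (cost e) + μ * (suc (cost e) + steps P)

iterations-mono : ∀ e P {μ ν} → μ ≤ ν → iterations e P μ ≤ iterations e P ν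
iterations-mono e P μ≤ν = +-monoʳ-≤ (suc (cost e)) (*-monoˡ-≤ _ μ≤ν)

module Hoare (S : ℕ) where
  open Machine S

  -- Only for loop-free commands; loops are handled by halts-while.
  wp : Cmd → (Memory → Set) → Memory → Set
  wp skip         Q M = Q M
  wp (d ≔ e)      Q M = ∃ λ a → ∃ λ x → M ⊢ d ⇓ a × M ⊢ e ⇓ x × Q (M [ a ↦ x ])
  wp (P ⨾ R)      Q M = wp P (wp R Q) M
  wp (cond e P R) Q M = ∃ λ x → M ⊢ e ⇓ x × (x ≢ 0 → wp P Q M) × (x ≡ 0 → wp R Q M)
  wp (while e P)  Q M = ⊥

  Halts : Cmd → Memory → ℕ → (Memory → Set) → Set
  Halts P M b Q = ∃ λ M′ → ∃ λ t → ⟨ P , M ⟩⇓[ t ] M′ × t ≤ b × Q M′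

  wp-mono : ∀ P {Q Q′ : Memory → Set} {M} → (∀ {M′} → Q M′ → Q′ M′) → wp P Q M → wp P Q′ M
  wp-mono skip         f q                     = f q
  wp-mono (d ≔ e)      f (a , x , d⇓ , e⇓ , q) = a , x , d⇓ , e⇓ , f q
  wp-mono (P ⨾ R)      f p                     = wp-mono P (wp-mono R f) p
  wp-mono (cond e P R) f (x , e⇓ , p , r)      =
    x , e⇓ , (λ x≢0 → wp-mono P f (p x≢0)) , (λ x≡0 → wp-mono R f (r x≡0))

  opaque
    unfolding steps

    wp⇒halts : ∀ P {Q M} → wp P Q M → Halts P M (steps P) Q
    wp⇒halts skip    q                     = _ , _ , skip , ≤-refl , q
    wp⇒halts (d ≔ e) (a , x , d⇓ , e⇓ , q) = _ , _ , assign d⇓ e⇓ , ≤-refl , q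
    wp⇒halts (P ⨾ R) p with wp⇒halts P p
    ... | _ , _ , P⇓ , s≤ , r with wp⇒halts R r
    ... | _ , _ , R⇓ , t≤ , q = _ , _ , seq P⇓ R⇓ , +-mono-≤ s≤ t≤ , q
    wp⇒halts (cond e P R) (zero , e⇓ , _ , r) with wp⇒halts R (r refl)
    ... | _ , _ , R⇓ , t≤ , q =
      _ , _ , cond-f e⇓ R⇓ , s≤s (+-monoʳ-≤ (cost e) (≤-trans t≤ (m≤n+m _ (steps P)))) , q
    wp⇒halts (cond e P R) (suc _ , e⇓ , p , _) with wp⇒halts P (p λ ())
    ... | _ , _ , P⇓ , t≤ , q =
      _ , _ , cond-t e⇓ (λ ()) P⇓ , s≤s (+-monoʳ-≤ (cost e) (≤-trans t≤ (m≤m+n _ _))) , q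

  halts-seq : ∀ {P R M b d Q Q′} → Halts P M b Q →
              (∀ {M′} → Q M′ → Halts R M′ d Q′) → Halts (P ⨾ R) M (b + d) Q′
  halts-seq (_ , _ , P⇓ , s≤ , q) r with r q
  ... | _ , _ , R⇓ , t≤ , q′ = _ , _ , seq P⇓ R⇓ , +-mono-≤ s≤ t≤ , q′

  -- `I` carries a variant that drops in every round, so its initial value bounds the number of
  -- rounds. As it may drop by more than one, the recursion is on an upper bound `b` of the variant.
  halts-while : ∀ {e P} (I : ℕ → Memory → Set) →
    (∀ {μ M} → I μ M → ∃ λ x → M ⊢ e ⇓ x ×
       (x ≢ 0 → wp P (λ M′ → ∃ λ μ′ → μ′ < μ × I μ′ M′) M)) →
    ∀ {μ M} → I μ M →
    Halts (while e P) M (iterations e P μ) (λ M′ → (∃ λ μ′ → I μ′ M′) × M′ ⊢ e ⇓ 0)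
  halts-while {e} {P} I body {μ} = go μ ≤-refl
    where
    go : ∀ b {μ M} → μ ≤ b → I μ M →
         Halts (while e P) M (iterations e P μ) (λ M′ → (∃ λ μ′ → I μ′ M′) × M′ ⊢ e ⇓ 0)
    go b {μ} μ≤b i with body i
    ... | zero  , e⇓ , _ = _ , _ , while-f e⇓ , m≤m+n _ _ , (μ , i) , e⇓
    ... | suc _ , e⇓ , p with wp⇒halts P (p λ ())
    ...   | _ , s , P⇓ , s≤ , μ′ , μ′<μ , i′ with b
    ...     | zero  = contradiction (<-≤-trans μ′<μ μ≤b) n≮0
    ...     | suc b with go b (s≤s⁻¹ (≤-trans μ′<μ μ≤b)) i′
    ...       | _ , t , W⇓ , t≤ , q = _ , _ , while-t e⇓ (λ ()) P⇓ W⇓ , bound , q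
      where
      X = suc (cost e) + steps P
      open ≤-Reasoning
      bound : suc (cost e + (s + t)) ≤ iterations e P μ
      bound = begin
        suc (cost e + (s + t))               ≡⟨ cong suc (+-assoc (cost e) s t) ⟨
        suc (cost e + s + t)                 ≤⟨ +-mono-≤ (s≤s (+-monoʳ-≤ (cost e) s≤)) t≤ ⟩
        X + (suc (cost e) + μ′ * X)          ≡⟨ +-assoc X (suc (cost e)) _ ⟨
        X + suc (cost e) + μ′ * X            ≡⟨ cong (_+ μ′ * X) (+-comm X (suc (cost e))) ⟩
        suc (cost e) + X + μ′ * X            ≡⟨ +-assoc (suc (cost e)) X _ ⟩
        suc (cost e) + suc μ′ * X            ≤⟨ +-monoʳ-≤ (suc (cost e)) (*-monoˡ-≤ X μ′<μ) ⟩
        suc (cost e) + μ * X                 ∎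

  load⁻¹ : ∀ {M a x} → M ⊢ ! lit a ⇓ x → M a ≡ x
  load⁻¹ (load (lit _) _) = refl

-- Memory updates and the layout of the data structures

≡ᵇ-refl : ∀ a → (a ≡ᵇ a) ≡ true
≡ᵇ-refl zero    = refl
≡ᵇ-refl (suc a) = ≡ᵇ-refl a

update-same : ∀ M a x → (M [ a ↦ x ]) a ≡ x
update-same M a x rewrite ≡ᵇ-refl a = refl

update-other : ∀ M {a b} x → b ≢ a → (M [ a ↦ x ]) b ≡ M b
update-other M {a} {b} x b≢a with b ≡ᵇ a in eq
... | false = refl
... | true  = contradiction (≡ᵇ⇒≡ b a (subst T (sym eq) tt)) b≢a

module Layout (n k : ℕ) where

  -- Symbolic names of the cells. Addresses come from a bijection with `Fin cells`, so writes to
  -- differently named cells do not interfere, and for different regions `λ ()` settles the matter.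
  Loc : Set
  Loc = Fin 5 ⊎ Fin n ⊎ Fin 1 ⊎ Fin n ⊎ Fin n ⊎ Fin n × Fin k

  pattern scalar i = inj₁ i
  pattern nL     = scalar zero
  pattern kL     = scalar (suc zero)
  pattern scratch i = scalar (suc (suc i))
  pattern uL     = scratch zero
  pattern vL     = scratch (suc zero)
  pattern dL     = scratch (suc (suc zero))
  pattern parL v = inj₂ (inj₁ v)
  pattern topL   = inj₂ (inj₂ (inj₁ zero))
  pattern visL v = inj₂ (inj₂ (inj₂ (inj₁ v)))
  pattern degL v = inj₂ (inj₂ (inj₂ (inj₂ (inj₁ v))))
  pattern adjL v i = inj₂ (inj₂ (inj₂ (inj₂ (inj₂ (v , i)))))

  cells : ℕ
  cells = 5 + (n + (1 + (n + (n + n * k))))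

  cells↔Loc : Fin cells ↔ Loc
  cells↔Loc = +⊎ (+⊎ (+⊎ (+⊎ (+⊎ *↔×))))
    where
    +⊎ : ∀ {m o} {A : Set} → Fin o ↔ A → Fin (m + o) ↔ (Fin m ⊎ A)
    +⊎ {m} f = (↔-id (Fin m) ⊎-↔ f) ↔-∘ +↔⊎

  -- Opaque, so that unification can recover l from addr l.
  opaque
    addr : Loc → ℕ
    addr l = toℕ (Inverse.from cells↔Loc l)

    addr-injective : ∀ {l l′} → addr l ≡ addr l′ → l ≡ l′
    addr-injective eq =
      Injection.injective (Inverse⇒Injection (↔-sym cells↔Loc)) (toℕ-injective eq)

    addr-scalar : ∀ i → addr (scalar i) ≡ toℕ i
    addr-scalar i = toℕ-↑ˡ i _

    addr<size : ∀ l → addr l < cells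
    addr<size l = toℕ<n _

    addr-par : ∀ v → addr (parL v) ≡ 5 + toℕ v
    addr-par v = cong (5 +_) (toℕ-↑ˡ v _)

    addr-top : addr topL ≡ 5 + n
    addr-top = cong (5 +_) (trans (toℕ-↑ʳ n _) (+-identityʳ n))

    addr-vis : ∀ v → addr (visL v) ≡ 5 + (n + (1 + toℕ v))
    addr-vis v = cong (5 +_) (trans (toℕ-↑ʳ n _) (cong (λ a → n + suc a) (toℕ-↑ˡ v _)))

    addr-deg : ∀ v → addr (degL v) ≡ 5 + (n + (1 + (n + toℕ v)))
    addr-deg v = cong (5 +_) (trans (toℕ-↑ʳ n _) (cong (λ a → n + suc a)
      (trans (toℕ-↑ʳ n _) (cong (n +_) (toℕ-↑ˡ v _)))))

    addr-adj : ∀ v i → addr (adjL v i) ≡ 5 + (n + (1 + (n + (n + (k * toℕ v + toℕ i)))))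
    addr-adj v i = cong (5 +_) (trans (toℕ-↑ʳ n _) (cong (λ a → n + suc a)
      (trans (toℕ-↑ʳ n _) (cong (n +_) (trans (toℕ-↑ʳ n _) (cong (n +_) (toℕ-combine v i)))))))

  infix 8 _at_
  _at_ : Memory → Loc → ℕ
  M at l = M (addr l)

  at-same : ∀ M l x → (M [ addr l ↦ x ]) at l ≡ x
  at-same M l = update-same M (addr l)

  at-other : ∀ M l {l′} x → l′ ≢ l → (M [ addr l ↦ x ]) at l′ ≡ M at l′
  at-other M l x l′≢l = update-other M x (l′≢l ∘ addr-injective)

  Mark : List (Edge n) → Fin n → ℕ → Set
  Mark T v m = (v ∈ visited T × m ≡ 1) ⊎ (v ∉ visited T × m ≡ 0)

  -- The slots of a vertex form a stack: the head of the list lies in the highest used slot, whose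
  -- number is the length of the tail. Asking for that number in `Fin k` also bounds the length by
  -- `k`.
  Stored : Memory → Fin n → List (Fin n) → Set
  Stored M v []      = ⊤
  Stored M v (w ∷ l) = (∃ λ i → toℕ i ≡ length l × M at adjL v i ≡ toℕ w) × Stored M v l

  stored⇒length≤k : ∀ {M v l} → Stored M v l → length l ≤ k
  stored⇒length≤k {l = []}    _                  = z≤n
  stored⇒length≤k {l = _ ∷ _} ((i , i≡ , _) , _) = subst (_< k) i≡ (toℕ<n i)

  stored-cong : ∀ {M M′ v l} → (∀ i → toℕ i < length l → M′ at adjL v i ≡ M at adjL v i) →
                Stored M v l → Stored M′ v l
  stored-cong {l = []}    eq _ = tt
  stored-cong {l = _ ∷ _} eq ((i , i≡ , w≡) , st) =
    (i , i≡ , trans (eq i (≤-reflexive (cong suc i≡))) w≡) ,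
    stored-cong (λ j j< → eq j (m<n⇒m<1+n j<)) st

  record Rep (M : Memory) (T : List (Edge n)) (c : Fin n) (L : Vector (List (Fin n)) n) : Set where
    field
      n≡  : M at nL ≡ n
      k≡  : M at kL ≡ k
      top≡ : M at topL ≡ toℕ c
      par≡ : ∀ {x y} → (x , y) ∈ T → M at parL x ≡ toℕ y
      vis≡ : ∀ v → Mark T v (M at visL v)
      deg≡ : ∀ v → M at degL v ≡ length (L v)
      adj≡ : ∀ v → Stored M v (L v)

  open Rep

  rep-scratch : ∀ {M T c L} (i : Fin 3) x → Rep M T c L → Rep (M [ addr (scratch i) ↦ x ]) T c L
  rep-scratch {M} i x R = record
    { n≡ = trans (at-other M _ x λ ()) (n≡ R)
    ; k≡ = trans (at-other M _ x λ ()) (k≡ R)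
    ; top≡ = trans (at-other M _ x λ ()) (top≡ R)
    ; par≡ = λ xy → trans (at-other M _ x λ ()) (par≡ R xy)
    ; vis≡ = λ v → subst (Mark _ v) (sym (at-other M _ x λ ())) (vis≡ R v)
    ; deg≡ = λ v → trans (at-other M _ x λ ()) (deg≡ R v)
    ; adj≡ = λ v → stored-cong (λ _ _ → at-other M _ x λ ()) (adj≡ R v)
    }

  rep-top : ∀ {M T c L} c′ → Rep M T c L → Rep (M [ addr topL ↦ toℕ c′ ]) T c′ L
  rep-top {M} c′ R = record
    { n≡ = trans (at-other M topL _ λ ()) (n≡ R)
    ; k≡ = trans (at-other M topL _ λ ()) (k≡ R)
    ; top≡ = at-same M topL _
    ; par≡ = λ xy → trans (at-other M topL _ λ ()) (par≡ R xy)
    ; vis≡ = λ v → subst (Mark _ v) (sym (at-other M topL _ λ ())) (vis≡ R v)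
    ; deg≡ = λ v → trans (at-other M topL _ λ ()) (deg≡ R v)
    ; adj≡ = λ v → stored-cong (λ _ _ → at-other M topL _ λ ()) (adj≡ R v)
    }

  rep-visit : ∀ {M T c L w} y → w ∉ visited T → Rep M T c L →
              Rep ((M [ addr (visL w) ↦ 1 ]) [ addr (parL w) ↦ toℕ y ]) ((w , y) ∷ T) c L
  rep-visit {M} {T} {w = w} y w∉ R = record
    { n≡ = trans (outside λ { (inj₁ ()) ; (inj₂ ()) }) (n≡ R)
    ; k≡ = trans (outside λ { (inj₁ ()) ; (inj₂ ()) }) (k≡ R)
    ; top≡ = trans (outside λ { (inj₁ ()) ; (inj₂ ()) }) (top≡ R)
    ; par≡ = λ { (here refl) → at-same M₁ (parL w) _
               ; (there xy) → trans (outside λ { (inj₂ refl) → w∉ (∈-map⁺ proj₁ xy) }) (par≡ R xy) }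
    ; vis≡ = mark
    ; deg≡ = λ v → trans (outside λ { (inj₁ ()) ; (inj₂ ()) }) (deg≡ R v)
    ; adj≡ = λ v → stored-cong (λ _ _ → outside λ { (inj₁ ()) ; (inj₂ ()) }) (adj≡ R v)
    }
    where
    M₁ = M [ addr (visL w) ↦ 1 ]
    M₂ = M₁ [ addr (parL w) ↦ toℕ y ]
    outside : ∀ {l} → ¬ (l ≡ visL w ⊎ l ≡ parL w) → M₂ at l ≡ M at l
    outside l≢ = trans (at-other M₁ (parL w) _ (l≢ ∘ inj₂)) (at-other M (visL w) _ (l≢ ∘ inj₁))
    mark : ∀ v → Mark ((w , y) ∷ T) v (M₂ at visL v)
    mark v with v ≟ w | vis≡ R v
    ... | yes refl | _ =
      inj₁ (here refl , trans (at-other M₁ (parL w) _ λ ()) (at-same M (visL w) 1))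
    ... | no v≢w | m with outside {visL v} (λ { (inj₁ refl) → v≢w refl })
    ...   | eq with m
    ...     | inj₁ (v∈ , 1≡) = inj₁ (there v∈ , trans eq 1≡)
    ...     | inj₂ (v∉ , 0≡) = inj₂ ((λ { (here v≡w) → v≢w v≡w ; (there v∈) → v∉ v∈ }) , trans eq 0≡)

  -- Entries are discarded by lowering the count alone. This serves both for taking the latest arc
  -- and, with the empty list, for clearing.
  rep-shrink : ∀ {M T c L v} l → Stored M v l → Rep M T c L →
               Rep (M [ addr (degL v) ↦ length l ]) T c (updateAt L v (const l))
  rep-shrink {M} {v = v} l st R = record
    { n≡ = trans (at-other M (degL v) _ λ ()) (n≡ R)
    ; k≡ = trans (at-other M (degL v) _ λ ()) (k≡ R)
    ; top≡ = trans (at-other M (degL v) _ λ ()) (top≡ R)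
    ; par≡ = λ xy → trans (at-other M (degL v) _ λ ()) (par≡ R xy)
    ; vis≡ = λ u → subst (Mark _ u) (sym (at-other M (degL v) _ λ ())) (vis≡ R u)
    ; deg≡ = updateAt-elim (λ u l′ → (M [ addr (degL v) ↦ length l ]) at degL u ≡ length l′)
               (at-same M (degL v) _)
               (λ u u≢v → trans (at-other M (degL v) _ λ { refl → u≢v refl }) (deg≡ R u))
    ; adj≡ = updateAt-elim (Stored (M [ addr (degL v) ↦ length l ])) (keep st) (λ u _ → keep (adj≡ R u))
    }
    where
    keep : ∀ {u l′} → Stored M u l′ → Stored (M [ addr (degL v) ↦ length l ]) u l′
    keep = stored-cong (λ _ _ → at-other M (degL v) _ λ ())

  rep-store : ∀ {M T c L a i} b → toℕ i ≡ length (L a) → Rep M T c L →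
              Rep ((M [ addr (adjL a i) ↦ toℕ b ]) [ addr (degL a) ↦ suc (length (L a)) ])
                  T c (updateAt L a (b ∷_))
  rep-store {M} {L = L} {a} {i} b i≡ R = record
    { n≡ = trans (outside λ { (inj₁ ()) ; (inj₂ ()) }) (n≡ R)
    ; k≡ = trans (outside λ { (inj₁ ()) ; (inj₂ ()) }) (k≡ R)
    ; top≡ = trans (outside λ { (inj₁ ()) ; (inj₂ ()) }) (top≡ R)
    ; par≡ = λ xy → trans (outside λ { (inj₁ ()) ; (inj₂ ()) }) (par≡ R xy)
    ; vis≡ = λ u → subst (Mark _ u) (sym (outside λ { (inj₁ ()) ; (inj₂ ()) })) (vis≡ R u)
    ; deg≡ = updateAt-elim (λ u l′ → M₂ at degL u ≡ length l′)
               (at-same M₁ (degL a) _)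
               (λ u u≢a → trans (outside λ { (inj₂ refl) → u≢a refl }) (deg≡ R u))
    ; adj≡ = updateAt-elim (Stored M₂)
               ( (i , i≡ , trans (at-other M₁ (degL a) _ λ ()) (at-same M (adjL a i) _))
               , stored-cong (λ j j< → outside λ { (inj₁ refl) → <-irrefl i≡ j< }) (adj≡ R a))
               (λ u u≢a → stored-cong (λ j j< → outside λ { (inj₁ refl) → u≢a refl }) (adj≡ R u))
    }
    where
    M₁ = M [ addr (adjL a i) ↦ toℕ b ]
    M₂ = M₁ [ addr (degL a) ↦ suc (length (L a)) ]
    outside : ∀ {l} → ¬ (l ≡ adjL a i ⊎ l ≡ degL a) → M₂ at l ≡ M at l
    outside l≢ = trans (at-other M₁ (degL a) _ (l≢ ∘ inj₂)) (at-other M (adjL a i) _ (l≢ ∘ inj₁))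

-- Reading the stream

taken : ∀ {x} {A B : Set} → x ≢ 0 → A → (x ≢ 0 → A) × (x ≡ 0 → B)
taken x≢0 a = (λ _ → a) , λ x≡0 → contradiction x≡0 x≢0

skipped : ∀ {x} {A B : Set} → x ≡ 0 → B → (x ≢ 0 → A) × (x ≡ 0 → B)
skipped x≡0 b = (λ x≢0 → contradiction x≡0 x≢0) , λ _ → b

module Evaluation (n k : ℕ) .{{_ : NonZero n}} (S : ℕ) (size≤S : Layout.cells n k ≤ S) where
  open Machine S
  open Hoare S
  open Layout n k
  open Rep

  addr<S : ∀ l → addr l < S
  addr<S l = <-≤-trans (addr<size l) size≤S

  n<S : n < S
  n<S = <-≤-trans (≤-trans (m≤n+m (suc n) 4) (+-monoʳ-≤ 5 (m≤m+n n _))) size≤S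

  k<S : k < S
  k<S = ≤-trans (begin
    suc k                               ≤⟨ s≤s (m≤n*m k n) ⟩
    suc (n * k)                         ≤⟨ m≤n+m _ (n + n) ⟩
    (n + n) + suc (n * k)               ≡⟨ shift n (n * k) ⟩
    1 + (n + (n + n * k))               ≤⟨ m≤n+m _ n ⟩
    n + (1 + (n + (n + n * k)))         ≤⟨ m≤n+m _ 5 ⟩
    cells                               ∎) size≤S
    where
    open ≤-Reasoning
    shift : ∀ a b → (a + a) + suc b ≡ 1 + (a + (a + b))
    shift = solve-∀

  1<S : 1 < S
  1<S = ≤-trans (s≤s (s≤s z≤n)) size≤S

  0<S : 0 < S
  0<S = <-trans z<s 1<S

  vertex<S : (v : Fin n) → toℕ v < S
  vertex<S v = <-trans (toℕ<n v) n<S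

  summand<S : ∀ j {x} → j + x < S → x < S
  summand<S j {x} = ≤-<-trans (m≤n+m x j)

  scalar⇓ : ∀ {M} i → M ⊢ lit (toℕ i) ⇓ addr (scalar i)
  scalar⇓ i = subst (_ ⊢ lit (toℕ i) ⇓_) (sym (addr-scalar i))
                    (lit (subst (_< S) (addr-scalar i) (addr<S (scalar i))))

  load≡ : ∀ {M e a x} → M ⊢ e ⇓ a → M a ≡ x → x < S → M ⊢ ! e ⇓ x
  load≡ e⇓ refl x<S = load e⇓ x<S

  n̂⇓ : ∀ {M} → M at nL ≡ n → M ⊢ n̂ ⇓ n
  n̂⇓ n≡ = load≡ (scalar⇓ zero) n≡ n<S

  k̂⇓ : ∀ {M} → M at kL ≡ k → M ⊢ k̂ ⇓ k
  k̂⇓ k≡ = load≡ (scalar⇓ (suc zero)) k≡ k<S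

  û⇓ : ∀ {M x} → M at uL ≡ x → x < S → M ⊢ û ⇓ x
  û⇓ = load≡ (scalar⇓ (suc (suc zero)))

  v̂⇓ : ∀ {M x} → M at vL ≡ x → x < S → M ⊢ v̂ ⇓ x
  v̂⇓ = load≡ (scalar⇓ (suc (suc (suc zero))))

  lit⊕⇓ : ∀ {M e x} j → M ⊢ e ⇓ x → j + x < S → M ⊢ lit j ⊕ e ⇓ (j + x)
  lit⊕⇓ {x = x} j e⇓ lt = bin (lit (≤-<-trans (m≤m+n j x) lt)) e⇓ lt

  n̂⊕⇓ : ∀ {M e x} → M at nL ≡ n → M ⊢ e ⇓ x → n + x < S → M ⊢ n̂ ⊕ e ⇓ (n + x)
  n̂⊕⇓ n≡ e⇓ lt = bin (n̂⇓ n≡) e⇓ lt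

  region⇓ : ∀ {M e x} → M at nL ≡ n → M ⊢ e ⇓ x → 5 + (n + (1 + x)) < S →
            M ⊢ vis[ e ] ⇓ (5 + (n + (1 + x)))
  region⇓ n≡ e⇓ lt =
    lit⊕⇓ 5 (n̂⊕⇓ n≡ (lit⊕⇓ 1 e⇓ (summand<S n (summand<S 5 lt))) (summand<S 5 lt)) lt

  -- The layout puts the final address below the capacity; the partial sums leading to it are
  -- smaller, so this one bound pays for the whole evaluation.
  ⇓addr : ∀ {M e a l} → addr l ≡ a → (a < S → M ⊢ e ⇓ a) → M ⊢ e ⇓ addr l
  ⇓addr {l = l} eq e⇓ = subst (_ ⊢ _ ⇓_) (sym eq) (e⇓ (subst (_< S) eq (addr<S l)))

  par⇓ : ∀ {M e v} → M ⊢ e ⇓ toℕ v → M ⊢ par[ e ] ⇓ addr (parL v)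
  par⇓ {v = v} e⇓ = ⇓addr (addr-par v) (lit⊕⇓ 5 e⇓)

  top⇓ : ∀ {M} → M at nL ≡ n → M ⊢ top ⇓ addr topL
  top⇓ n≡ = ⇓addr addr-top (lit⊕⇓ 5 (n̂⇓ n≡))

  vis⇓ : ∀ {M e v} → M at nL ≡ n → M ⊢ e ⇓ toℕ v → M ⊢ vis[ e ] ⇓ addr (visL v)
  vis⇓ {v = v} n≡ e⇓ = ⇓addr (addr-vis v) (region⇓ n≡ e⇓)

  deg⇓ : ∀ {M e v} → M at nL ≡ n → M ⊢ e ⇓ toℕ v → M ⊢ deg[ e ] ⇓ addr (degL v)
  deg⇓ {v = v} n≡ e⇓ = ⇓addr (addr-deg v) λ lt →
    region⇓ n≡ (n̂⊕⇓ n≡ e⇓ (summand<S 1 (summand<S n (summand<S 5 lt)))) lt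

  adj⇓ : ∀ {M e d v i} → M at nL ≡ n → M at kL ≡ k → M ⊢ e ⇓ toℕ v → M ⊢ d ⇓ toℕ i →
         M ⊢ adj[ e , d ] ⇓ addr (adjL v i)
  adj⇓ {v = v} {i} n≡ k≡ e⇓ d⇓ = ⇓addr (addr-adj v i) λ lt →
    let lt₁ = summand<S 1 (summand<S n (summand<S 5 lt))
        lt₂ = summand<S n lt₁
        lt₃ = summand<S n lt₂
    in region⇓ n≡ (n̂⊕⇓ n≡ (n̂⊕⇓ n≡
         (bin (bin (k̂⇓ k≡) e⇓ (≤-<-trans (m≤m+n _ (toℕ i)) lt₃)) d⇓ lt₃) lt₂) lt₁) lt

  length<S : ∀ {M T c L} → Rep M T c L → ∀ v → length (L v) < S
  length<S R v = ≤-<-trans (stored⇒length≤k (adj≡ R v)) k<S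

  top-value : ∀ {M T c L} → Rep M T c L → M ⊢ ! top ⇓ toℕ c
  top-value {c = c} R = load≡ (top⇓ (n≡ R)) (top≡ R) (vertex<S c)

  deg-value : ∀ {M T c L e v} → Rep M T c L → M ⊢ e ⇓ toℕ v → M ⊢ ! deg[ e ] ⇓ length (L v)
  deg-value {v = v} R e⇓ = load≡ (deg⇓ (n≡ R) e⇓) (deg≡ R v) (length<S R v)

  Agree : Memory → Memory → Set
  Agree M M′ = ∀ i → M′ at scratch i ≡ M at scratch i

  module _ {T : List (Edge n)} {c : Fin n} where
    open Collecting k (visited T)

    Offered : List (Edge n) → Memory → Memory → Set
    Offered as M M′ = Agree M M′ × ∃ λ L → Rep M′ T c L × CollectedAll as L

    -- The operands are evaluated again after the slot has been written, hence they are assumed to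
    -- have their values in every memory with the same scratch cells. That the arc is new keeps the
    -- lists duplicate-free.
    offer-wp : ∀ {M L as a b x y} → Rep M T c L → CollectedAll as L → (a , b) ∉ as →
               (∀ {M′} → Agree M M′ → M′ ⊢ x ⇓ toℕ a) →
               (∀ {M′} → Agree M M′ → M′ ⊢ y ⇓ toℕ b) →
               wp (offer x y) (Offered ((a , b) ∷ as) M) M
    offer-wp {M} {L} {as} {a} {b} R C ab∉ x⇓ y⇓ with vis≡ R b
    ... | inj₁ (b∈ , 1≡) =
      _ , load≡ (vis⇓ (n≡ R) (y⇓ λ _ → refl)) 1≡ 1<S , taken (λ ())
        ((λ _ → refl) , L , R , collect-skip (λ _ → b∈) C)
    ... | inj₂ (b∉ , 0≡) =
      _ , load≡ (vis⇓ (n≡ R) (y⇓ λ _ → refl)) 0≡ 0<S , skipped refl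
        (_ , bin (k̂⇓ (k≡ R)) (deg-value R (x⇓ λ _ → refl)) (≤-<-trans (m∸n≤m k (length (L a))) k<S) , room)
      where
      room : (k ∸ length (L a) ≢ 0 → _) × (k ∸ length (L a) ≡ 0 → _)
      room with length (L a) <? k
      ... | no  full = skipped (m≤n⇒m∸n≡0 (≮⇒≥ full))
        ((λ _ → refl) , L , R , collect-skip (λ l<k → contradiction l<k full) C)
      ... | yes l<k = taken (m>n⇒m∸n≢0 l<k)
        ( addr (adjL a i) , toℕ b
        , adj⇓ (n≡ R) (k≡ R) (x⇓ λ _ → refl)
            (subst (_ ⊢ _ ⇓_) (sym i≡) (deg-value R (x⇓ λ _ → refl)))
        , y⇓ (λ _ → refl)
        , addr (degL a) , suc (length (L a))
        , deg⇓ n≡₁ (x⇓ agree₁)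
        , lit⊕⇓ 1 (load≡ (deg⇓ n≡₁ (x⇓ agree₁)) deg≡₁ (length<S R a)) (≤-<-trans l<k k<S)
        , (λ j → trans (at-other M₁ (degL a) _ λ ()) (agree₁ j))
        , updateAt L a (b ∷_) , rep-store b i≡ R , collect-store b∉ l<k ab∉ C )
        where
        i = fromℕ< l<k
        i≡ : toℕ i ≡ length (L a)
        i≡ = toℕ-fromℕ< l<k
        M₁ = M [ addr (adjL a i) ↦ toℕ b ]
        agree₁ : Agree M M₁
        agree₁ j = at-other M (adjL a i) _ λ ()
        n≡₁ : M₁ at nL ≡ n
        n≡₁ = trans (at-other M (adjL a i) _ λ ()) (n≡ R)
        deg≡₁ : M₁ at degL a ≡ length (L a)
        deg≡₁ = trans (at-other M (adjL a i) _ λ ()) (deg≡ R a)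

    open Execution S dfs using (ReadAll; []; _∷_)
    open StreamingAlgorithm dfs

    receive≡ : ∀ {u v : Fin n} {M} →
      receive (u , v) M ≡ (M [ addr uL ↦ toℕ u ]) [ addr vL ↦ toℕ v ]
    receive≡ {u} {v} {M} = sym (cong₂ (λ p q → (M [ p ↦ toℕ u ]) [ q ↦ toℕ v ])
      (addr-scalar _) (addr-scalar _))

    Collects : List (Edge n) → Memory → Memory → Set
    Collects as M M′ = M′ at dL ≡ M at dL × ∃ λ L → Rep M′ T c L × CollectedAll as L

    onEdge-wp : ∀ {M L as u v} → Rep M T c L → CollectedAll as L →
                u ≢ v → (u , v) ∉ as → (v , u) ∉ as →
                wp onEdge (Collects ((v , u) ∷ (u , v) ∷ as) M)
                   ((M [ addr uL ↦ toℕ u ]) [ addr vL ↦ toℕ v ])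
    onEdge-wp {M} {as = as} {u} {v} R C u≢v uv∉ vu∉ =
      wp-mono (offer û v̂) {Offered _ M₂} {wp (offer v̂ û) Q}
        (λ {M′} (ag₁ , _ , R₁ , C₁) →
          wp-mono (offer v̂ û) {Offered _ M′} {Q}
            (λ (ag₂ , L₂ , R₂ , C₂) →
              trans (ag₂ _) (trans (ag₁ _)
                (trans (at-other M₁ vL _ λ ()) (at-other M uL _ λ ()))) , L₂ , R₂ , C₂)
            (offer-wp R₁ C₁
              (λ { (here refl) → u≢v refl ; (there vu) → vu∉ vu })
              (λ ag₂ → v⇓ (λ j → trans (ag₂ j) (ag₁ j))) (λ ag₂ → u⇓ (λ j → trans (ag₂ j) (ag₁ j)))))
        (offer-wp (rep-scratch (suc zero) _ (rep-scratch zero _ R)) C uv∉ u⇓ v⇓)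
      where
      Q = Collects ((v , u) ∷ (u , v) ∷ as) M
      M₁ = M [ addr uL ↦ toℕ u ]
      M₂ = M₁ [ addr vL ↦ toℕ v ]
      u⇓ : ∀ {M′} → Agree M₂ M′ → M′ ⊢ û ⇓ toℕ u
      u⇓ ag = û⇓ (trans (ag zero) (trans (at-other M₁ vL _ λ ()) (at-same M uL _))) (vertex<S u)
      v⇓ : ∀ {M′} → Agree M₂ M′ → M′ ⊢ v̂ ⇓ toℕ v
      v⇓ ag = v̂⇓ (trans (ag (suc zero)) (at-same M₁ vL _)) (vertex<S v)

    onEdge-halts : ∀ {M L as e} → Rep M T c L → CollectedAll as L →
                   proj₁ e ≢ proj₂ e → e ∉ as → swap e ∉ as →
                   Halts onEdge (receive e M) (steps onEdge) (Collects (swap e ∷ e ∷ as) M)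
    onEdge-halts {M} {as = as} {e} R C u≢v uv∉ vu∉ =
      subst (λ N → Halts onEdge N (steps onEdge) (Collects (swap e ∷ e ∷ as) M)) (sym receive≡)
        (wp⇒halts onEdge {Collects (swap e ∷ e ∷ as) M} {_ [ _ ↦ _ ]} (onEdge-wp R C u≢v uv∉ vu∉))

    ReadHalts : List (Edge n) → List (Edge n) → Memory → Set
    ReadHalts es as M = ∃ λ M′ → ∃ λ t →
      ReadAll es M t M′ × t ≤ length es * suc (steps onEdge) × Collects as M M′

    read-∷ : ∀ {e es as as₁ M} →
             Halts onEdge (receive e M) (steps onEdge) (Collects as₁ M) →
             (∀ {M₁ L₁} → Rep M₁ T c L₁ → CollectedAll as₁ L₁ → ReadHalts es as M₁) →
             ReadHalts (e ∷ es) as M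
    read-∷ (_ , _ , run₁ , s≤ , d₁ , _ , R₁ , C₁) rest with rest R₁ C₁
    ... | _ , _ , run₂ , t≤ , d₂ , L₂ , R₂ , C₂ =
      _ , _ , run₁ ∷ run₂ , s≤s (+-mono-≤ s≤ t≤) , trans d₂ d₁ , L₂ , R₂ , C₂

    -- The last hypothesis separates the edges to come from the arcs already offered. Together with
    -- distinctness it makes both arcs of the next edge new, and it passes to the remaining edges.
    read : ∀ es {as M L} → Rep M T c L → CollectedAll as L →
           AllPairs (λ e f → ¬ SameEdge e f) es → All (λ e → proj₁ e ≢ proj₂ e) es →
           All (λ e → ∀ {a} → a ∈ as → ¬ SameEdge e a) es →
           ReadHalts es (arcs es as) M
    read []       R C _ _ _ = _ , _ , [] , z≤n , refl , _ , R , C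
    read (e ∷ es) {as} R C (e∉ ∷ dist) (u≢v ∷ loops) (fresh-e ∷ fresh) =
      read-∷ (onEdge-halts R C u≢v (λ e∈ → fresh-e e∈ (inj₁ refl)) (λ e∈ → fresh-e e∈ (inj₂ refl)))
        λ R₁ C₁ → read es R₁ C₁ dist loops (All.zipWith fresh′ (e∉ , fresh))
      where
      fresh′ : ∀ {f} → (¬ SameEdge e f × (∀ {a} → a ∈ as → ¬ SameEdge f a)) →
               ∀ {a} → a ∈ swap e ∷ e ∷ as → ¬ SameEdge f a
      fresh′ (¬ef , _)  (here refl)         s = ¬ef (sameEdge-sym (sameEdge-trans s (inj₂ refl)))
      fresh′ (¬ef , _)  (there (here refl)) s = ¬ef (sameEdge-sym s)
      fresh′ (_   , fr) (there (there a∈))  s = fr a∈ s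

-- The search at the end of a pass

shrink-potential : ∀ {A : Set} {n} {L : Vector (List A) n} {i w l} → L i ≡ w ∷ l →
                   suc (total (updateAt L i (const l))) ≡ total L
shrink-potential {L = L} {i} {w} {l} eq = +-cancelʳ-≡ (length l) _ _ (begin
  suc (total (updateAt L i (const l))) + length l  ≡⟨ +-suc _ (length l) ⟨
  total (updateAt L i (const l)) + suc (length l)  ≡⟨ cong (λ l′ → total (updateAt L i (const l)) + length l′) eq ⟨
  total (updateAt L i (const l)) + length (L i)    ≡⟨ total-updateAt L i (const l) ⟩
  total L + length l                               ∎)
  where open ≡-Reasoning

total-empty : ∀ {A : Set} {n} (L : Vector (List A) n) → (∀ i → L i ≡ []) → total L ≡ 0
total-empty {n = zero}  L L≡[] = refl
total-empty {n = suc n} L L≡[] =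
  cong₂ _+_ (cong length (L≡[] zero)) (total-empty (tail L) (L≡[] ∘ suc))

endTime passTime : ℕ → ℕ → ℕ
endTime n μ = steps (lit uCell ≔ k̂) + (iterations û advance μ +
              (steps (lit uCell ≔ n̂) + iterations û clear n))
-- The variant of the search is at most `4 * m + n`: twice the at most 2m stored arcs, plus a stack
-- of at most n vertices.
passTime n m = m * suc (steps onEdge) + endTime n (4 * m + n)
  where open StreamingAlgorithm dfs

module Passes (n k : ℕ) .{{_ : NonZero n}} .{{_ : NonZero k}} (S : ℕ) (size≤S : Layout.cells n k ≤ S)
              (G : Graph n) (root : Fin n) (root≡0 : toℕ root ≡ 0) (connected : Connected G) where
  open Machine S
  open Hoare S
  open Layout n k
  open Evaluation n k S size≤S
  open Rep
  open DepthFirst G root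
  open Search
  open DecMembership (_≟_ {n}) using (_∈?_)

  Complete : Memory → Set
  Complete M = ∃ λ T → ∃ λ c → ∃ λ s → ∃ λ L →
    Rep M T c L × Search T c s × (∀ v → v ∈ visited T)

  Outcome : List (Edge n) → List (Edge n) → Memory → Set
  Outcome T₀ T M = (M at dL ≡ 1 × (∀ v → v ∈ visited T)) ⊎ (M at dL ≡ 0 × length T ≡ k + length T₀)

  Ended : List (Edge n) → Memory → Set
  Ended T₀ M = ∃ λ T → ∃ λ c → ∃ λ s → ∃ λ L → Rep M T c L × Search T c s × Outcome T₀ T M

  û⇓0⇒u≡0 : ∀ {M} → M ⊢ û ⇓ 0 → M at uL ≡ 0
  û⇓0⇒u≡0 {M} û⇓0 = trans (cong M (addr-scalar (suc (suc zero)))) (load⁻¹ û⇓0)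

  module DFSLoop (T₀ : List (Edge n)) {as : List (Edge n)} {O : Vector (List (Fin n)) n}
                 (C : Collecting.CollectedAll k (visited T₀) as O)
                 (adj⇒as : ∀ {u v} → Adj G u v → (u , v) ∈ as) where
    open Collecting k (visited T₀)
    open Collected
    open CollectedAll C

    -- `O v` is fixed at the end of the reading, while `l` is what the search has left of it: an arc
    -- may disappear only if its head is visited.
    Pending : List (Edge n) → Fin n → List (Fin n) → Set
    Pending T v l = ∀ {w} → w ∈ O v → w ∈ visited T ⊎ w ∈ l

    -- `new` is the part of the tree added in this pass, kept apart from `T₀` so that it can be
    -- counted; `r` is the number of vertices that may still be added.
    record Running (new : List (Edge n)) (c : Fin n) (s : List (Fin n))
                   (L : Vector (List (Fin n)) n) (r : ℕ) (M : Memory) : Set where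
      field
        rep     : Rep M (new ++ T₀) c L
        search  : Search (new ++ T₀) c s
        budget  : length new + r ≡ k
        u≡      : M at uL ≡ r
        d≡      : M at dL ≡ 0
        pending : ∀ v → Pending (new ++ T₀) v (L v)
        stored⇒adj : ∀ v {w} → w ∈ L v → Adj G v w

    open Running

    -- A descent uses up one arc but pushes a vertex, hence the weight 2; a retreat pops a vertex.
    -- The successor counts the current vertex and leaves room for the last step, from the root to
    -- variant 0.
    potential : Vector (List (Fin n)) n → List (Fin n) → ℕ
    potential L s = 2 * total L + suc (length s)

    Finished : Memory → Set
    Finished M = M at uL ≡ 0 × M at dL ≡ 1 × Complete M

    Inv : ℕ → Memory → Set
    Inv μ M = (∃ λ new → ∃ λ c → ∃ λ s → ∃ λ L → ∃ λ r →
                 Running new c s L r M × μ ≡ potential L s)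
            ⊎ Finished M

    Decreased : ℕ → Memory → Set
    Decreased μ M = ∃ λ μ′ → μ′ < μ × Inv μ′ M

    -- A vertex for which k arcs were stored cannot run out of them before the
    -- pass has visited k vertices; with fewer arcs stored none was dropped.
    exhausted⇒closed : ∀ {new c s L r M} → Running new c s L r M → L c ≡ [] → r ≢ 0 →
                       Closed (new ++ T₀) c
    exhausted⇒closed {new} {c} {L = L} {r} R L≡[] r≢0 w c~w with length (O c) <? k
    ... | no full = contradiction
      (≤-trans (≮⇒≥ full) (unique⊆⇒length≤ (unique (collected c)) O⊆new)) (<⇒≱ (begin-strict
        length (visited new) ≡⟨ length-map proj₁ new ⟩
        length new           <⟨ m<m+n (length new) (n≢0⇒n>0 r≢0) ⟩
        length new + r       ≡⟨ budget R ⟩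
        k                    ∎))
      where
      open ≤-Reasoning
      O⊆new : ∀ {v} → v ∈ O c → v ∈ visited new
      O⊆new {v} v∈ with pending R c v∈
      ... | inj₂ v∈L = contradiction (subst (v ∈_) L≡[] v∈L) λ ()
      ... | inj₁ v∈T with ∈-++⁻ (visited new) (subst (v ∈_) (map-++ proj₁ new T₀) v∈T)
      ...   | inj₁ v∈new = v∈new
      ...   | inj₂ v∈T₀  = contradiction v∈T₀ (proj₁ (sound (collected c) v∈))
    ... | yes O<k with w ∈? visited T₀
    ...   | yes w∈ = subst (w ∈_) (sym (map-++ proj₁ new T₀)) (∈-++⁺ʳ (visited new) w∈)
    ...   | no w∉ with pending R c (complete (collected c) O<k w∉ (adj⇒as c~w))
    ...     | inj₁ w∈T = w∈T
    ...     | inj₂ w∈L = contradiction (subst (w ∈_) L≡[] w∈L) λ ()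

    retreat-wp : ∀ {new c s L r M} → Running new c s L r M → L c ≡ [] → r ≢ 0 →
                 wp retreat (Decreased (potential L s)) M
    retreat-wp {new} {L = L} {M = M} R L≡[] r≢0 = go R L≡[] (stack (search R))
      where
      go : ∀ {c s} → Running new c s L _ M → L c ≡ [] → Stack (new ++ T₀) c s →
           wp retreat (Decreased (potential L s)) M
      go R L≡[] bottom =
        _ , top-value (rep R) , skipped root≡0
          ( _ , 1 , scalar⇓ (suc (suc (suc (suc zero)))) , lit 1<S
          , _ , 0 , scalar⇓ (suc (suc zero)) , lit 0<S
          , 0 , ≤-trans z<s (m≤n+m 1 (2 * total L)) , inj₂
            ( at-same M₁ uL 0
            , trans (at-other M₁ uL 0 λ ()) (at-same M dL 1)
            , _ , _ , _ , L
            , rep-scratch zero 0 (rep-scratch (suc (suc zero)) 1 (rep R))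
            , search R
            , search-finish connected (exhausted⇒closed R L≡[] r≢0) (search R) ))
        where M₁ = M [ addr dL ↦ 1 ]
      go {c} {s = y ∷ s} R L≡[] (push xy c≢root _) =
        _ , top-value (rep R) , taken (λ c≡0 → c≢root (toℕ-injective (trans c≡0 (sym root≡0))))
          ( addr topL , toℕ y , top⇓ (n≡ (rep R))
          , load≡ (par⇓ (top-value (rep R))) (par≡ (rep R) xy) (vertex<S y)
          , potential L s , +-monoʳ-< (2 * total L) ≤-refl , inj₁
            ( new , y , s , L , _ , record
              { rep = rep-top y (rep R)
              ; search = search-retreat (exhausted⇒closed R L≡[] r≢0) (search R)
              ; budget = budget R
              ; u≡ = trans (at-other M topL _ λ ()) (u≡ R)
              ; d≡ = trans (at-other M topL _ λ ()) (d≡ R)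
              ; pending = pending R
              ; stored⇒adj = stored⇒adj R
              } , refl ))

    -- `L` describes the lists before the arc to `w` was taken and `L′` those after. The decrease is
    -- measured from `L`, since taking the arc and descending belong to the same round.
    descend-wp : ∀ {new c s L L′ r M w} → Rep M (new ++ T₀) c L′ → Search (new ++ T₀) c s →
                 length new + r ≡ k → M at uL ≡ r → M at vL ≡ toℕ w → M at dL ≡ 0 →
                 (∀ v → Pending ((w , c) ∷ new ++ T₀) v (L′ v)) →
                 (∀ v {w} → w ∈ L′ v → Adj G v w) →
                 suc (total L′) ≡ total L → w ∉ visited (new ++ T₀) → Adj G c w → r ≢ 0 →
                 wp descend (Decreased (potential L s)) M
    descend-wp {new} {c} {s} {L} {L′} {r} {M} {w} R Sr budget u≡ v≡ d≡ pend adj t≡ w∉ c~w r≢0 =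
      _ , 1 , vis⇓ (n≡ R) (v̂⇓ v≡ (vertex<S w)) , lit 1<S ,
      _ , toℕ c , par⇓ (v̂⇓ v≡₁ (vertex<S w))
        , load≡ (top⇓ n≡₁) (trans (at-other M (visL w) _ λ ()) (top≡ R)) (vertex<S c) ,
      _ , toℕ w , top⇓ (n≡ R₂) , v̂⇓ (trans (at-other M₁ (parL w) _ λ ()) v≡₁) (vertex<S w) ,
      _ , r ∸ 1 , scalar⇓ (suc (suc zero))
        , bin (û⇓ (trans (scratch₃ zero) u≡) (≤-<-trans (m≤n+m r (length new)) (subst (_< S) (sym budget) k<S)))
              (lit 1<S)
              (≤-<-trans (m∸n≤m r 1) (≤-<-trans (m≤n+m r (length new)) (subst (_< S) (sym budget) k<S))) ,
      potential L′ (c ∷ s) , potential< , inj₁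
        ( (w , c) ∷ new , w , c ∷ s , L′ , r ∸ 1 , record
          { rep = rep-scratch zero _ (rep-top w R₂)
          ; search = search-visit w∉ c~w Sr
          ; budget = trans (sym (+-suc (length new) (r ∸ 1)))
                       (trans (cong (length new +_) (m+[n∸m]≡n (n≢0⇒n>0 r≢0))) budget)
          ; u≡ = at-same M₃ uL _
          ; d≡ = trans (at-other M₃ uL _ λ ()) (trans (scratch₃ (suc (suc zero))) d≡)
          ; pending = pend
          ; stored⇒adj = adj
          } , refl )
      where
      M₁ = M [ addr (visL w) ↦ 1 ]
      M₂ = M₁ [ addr (parL w) ↦ toℕ c ]
      M₃ = M₂ [ addr topL ↦ toℕ w ]
      n≡₁ : M₁ at nL ≡ n
      n≡₁ = trans (at-other M (visL w) _ λ ()) (n≡ R)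
      v≡₁ : M₁ at vL ≡ toℕ w
      v≡₁ = trans (at-other M (visL w) _ λ ()) v≡
      R₂ : Rep M₂ ((w , c) ∷ new ++ T₀) c L′
      R₂ = rep-visit c w∉ R
      scratch₃ : Agree M M₃
      scratch₃ i = trans (at-other M₂ topL _ λ ())
        (trans (at-other M₁ (parL w) _ λ ()) (at-other M (visL w) _ λ ()))
      potential< : potential L′ (c ∷ s) < potential L s
      potential< = ≤-reflexive (trans (shift (total L′) (length s))
                     (cong (λ t → 2 * t + suc (length s)) t≡))
        where
        shift : ∀ t d → suc (2 * t + suc (suc d)) ≡ 2 * suc t + suc d
        shift = solve-∀

    scan-wp : ∀ {new c s L r M w l} → Running new c s L r M → L c ≡ w ∷ l → r ≢ 0 →
              wp scan (Decreased (potential L s)) M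
    scan-wp {new} {c} {s} {L} {r} {M} {w} {l} R L≡ r≢0
      with subst (Stored M c) L≡ (adj≡ (rep R) c)
    ... | (i , i≡ , w≡) , st =
      addr (degL c) , length l , deg⇓ (n≡ (rep R)) (top-value (rep R))
        , subst (λ l′ → M ⊢ ! deg[ ! top ] ⊖ lit 1 ⇓ (length l′ ∸ 1)) L≡
            (bin (deg-value (rep R) (top-value (rep R))) (lit 1<S)
                 (≤-<-trans (m∸n≤m (length (L c)) 1) (length<S (rep R) c))) ,
      addr vL , toℕ w , scalar⇓ (suc (suc (suc zero)))
        , load≡ (adj⇓ (n≡ R₁) (k≡ R₁) (top-value R₁)
                  (subst (M₁ ⊢ ! deg[ ! top ] ⇓_) index≡ (deg-value R₁ (top-value R₁))))
                (trans (at-other M (degL c) _ λ ()) w≡) (vertex<S w) ,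
      M₂ at visL w , load≡ (vis⇓ (n≡ R₂) (v̂⇓ v≡ (vertex<S w))) refl mark<S , branch
      where
      L′ = updateAt L c (const l)
      M₁ = M [ addr (degL c) ↦ length l ]
      M₂ = M₁ [ addr vL ↦ toℕ w ]
      R₁ : Rep M₁ (new ++ T₀) c L′
      R₁ = rep-shrink l st (rep R)
      R₂ : Rep M₂ (new ++ T₀) c L′
      R₂ = rep-scratch (suc zero) _ R₁
      -- The lowered count is the number of the slot that holds the arc just removed.
      index≡ : length (L′ c) ≡ toℕ i
      index≡ = trans (cong length (updateAt-updates c L)) (sym i≡)
      v≡ : M₂ at vL ≡ toℕ w
      v≡ = at-same M₁ vL _
      u≡₂ : M₂ at uL ≡ r
      u≡₂ = trans (at-other M₁ vL _ λ ()) (trans (at-other M (degL c) _ λ ()) (u≡ R))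
      d≡₂ : M₂ at dL ≡ 0
      d≡₂ = trans (at-other M₁ vL _ λ ()) (trans (at-other M (degL c) _ λ ()) (d≡ R))
      mark<S : M₂ at visL w < S
      mark<S with vis≡ R₂ w
      ... | inj₁ (_ , 1≡) = subst (_< S) (sym 1≡) 1<S
      ... | inj₂ (_ , 0≡) = subst (_< S) (sym 0≡) 0<S
      -- `T` is either the present tree, which already contains `w`, or its extension by `w`; both
      -- branches can thus drop `w` from the list.
      pend : ∀ {T} → (∀ {v} → v ∈ visited (new ++ T₀) → v ∈ visited T) → w ∈ visited T →
             ∀ v → Pending T v (L′ v)
      pend {T} mono w∈ = updateAt-elim (Pending T)
        (λ x∈ → case pending R c x∈ of λ
          { (inj₁ x∈T) → inj₁ (mono x∈T)
          ; (inj₂ x∈L) → case subst (_ ∈_) L≡ x∈L of λ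
              { (here refl) → inj₁ w∈ ; (there x∈l) → inj₂ x∈l } })
        (λ v _ x∈ → case pending R v x∈ of λ
          { (inj₁ x∈T) → inj₁ (mono x∈T) ; (inj₂ x∈L) → inj₂ x∈L })
      adj : ∀ v {x} → x ∈ L′ v → Adj G v x
      adj = updateAt-elim (λ v l′ → ∀ {x} → x ∈ l′ → Adj G v x)
        (λ x∈ → stored⇒adj R c (subst (_ ∈_) (sym L≡) (there x∈)))
        (λ v _ → stored⇒adj R v)
      potential< : potential L′ s < potential L s
      potential< = +-monoˡ-< (suc (length s))
        (*-monoʳ-< 2 (≤-reflexive (shrink-potential {L = L} L≡)))
      branch : (M₂ at visL w ≢ 0 → Decreased (potential L s) M₂) ×
               (M₂ at visL w ≡ 0 → wp descend (Decreased (potential L s)) M₂)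
      branch with vis≡ R₂ w
      ... | inj₁ (w∈ , 1≡) = taken (λ 0≡ → contradiction (trans (sym 1≡) 0≡) λ ())
        (potential L′ s , potential< , inj₁ (new , c , s , L′ , r , record
          { rep = R₂ ; search = search R ; budget = budget R ; u≡ = u≡₂ ; d≡ = d≡₂
          ; pending = pend (λ v∈ → v∈) w∈ ; stored⇒adj = adj } , refl))
      ... | inj₂ (w∉ , 0≡) = skipped 0≡
        (descend-wp {L = L} R₂ (search R) (budget R) u≡₂ v≡ d≡₂ (pend {(w , c) ∷ new ++ T₀} there (here refl)) adj
          (shrink-potential {L = L} L≡) w∉
          (stored⇒adj R c (subst (w ∈_) (sym L≡) (here refl))) r≢0)

    advance-wp : ∀ {new c s L r M} → Running new c s L r M → r ≢ 0 →
                 wp advance (Decreased (potential L s)) M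
    advance-wp {c = c} {L = L} R r≢0 =
      _ , deg-value (rep R) (top-value (rep R)) , branch
      where
      branch : (length (L c) ≢ 0 → _) × (length (L c) ≡ 0 → _)
      branch with L c in eq
      ... | []    = skipped refl (retreat-wp R eq r≢0)
      ... | _ ∷ _ = taken (λ ()) (scan-wp R eq r≢0)

    advance-loop : ∀ {c s M} → Running [] c s O k M →
                   Halts (while û advance) M (iterations û advance (potential O s)) (Ended T₀)
    advance-loop {c} {s} R with halts-while Inv body (inj₁ ([] , c , s , O , k , R , refl))
      where
      body : ∀ {μ M} → Inv μ M → ∃ λ x → M ⊢ û ⇓ x × (x ≢ 0 → wp advance (Decreased μ) M)
      body (inj₁ (new , _ , _ , _ , r , R , refl)) =
        r , û⇓ (u≡ R) (≤-<-trans (≤-trans (m≤n+m r (length new)) (≤-reflexive (budget R))) k<S)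
          , advance-wp R
      body (inj₂ (0≡ , _)) = 0 , û⇓ 0≡ 0<S , λ 0≢0 → contradiction refl 0≢0
    ... | _ , _ , run , t≤ , (_ , inj₂ (_ , d≡1 , T , c , s , L , R , Sr , all)) , _ =
      _ , _ , run , t≤ , T , c , s , L , R , Sr , inj₁ (d≡1 , all)
    -- The loop stopped although the search is unfinished, so the counter `r` is 0 and the budget
    -- equation says that `new` has length `k`.
    ... | M′ , _ , run , t≤ , (_ , inj₁ (new , c , s , L , r , R , _)) , û⇓0 =
      _ , _ , run , t≤ , new ++ T₀ , c , s , L , rep R , search R , inj₂ (d≡ R , (begin
        length (new ++ T₀)             ≡⟨ length-++ new ⟩
        length new + length T₀         ≡⟨ cong (_+ length T₀) (+-identityʳ (length new)) ⟨
        length new + 0 + length T₀     ≡⟨ cong (λ r → length new + r + length T₀) (û⇓0⇒u≡0 û⇓0) ⟨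
        length new + M′ at uL + length T₀ ≡⟨ cong (λ r → length new + r + length T₀) (u≡ R) ⟩
        length new + r + length T₀     ≡⟨ cong (_+ length T₀) (budget R) ⟩
        k + length T₀                  ∎))
      where open ≡-Reasoning

  -- Clearing the lists and chaining the passes

  Cleared : List (Edge n) → Fin n → Memory → Set
  Cleared T c M = ∃ λ L → Rep M T c L × (∀ v → L v ≡ [])

  -- The counter runs down from n and is its own variant; the lists of all vertices from the counter
  -- upwards are empty. Only counts are reset, so the time does not depend on `k`.
  clear-loop : ∀ {T c L d M} → Rep M T c L → M at uL ≡ n → M at dL ≡ d →
               Halts (while û clear) M (iterations û clear n) (λ M′ → M′ at dL ≡ d × Cleared T c M′)
  clear-loop {T} {c} {L} {d} R u≡ d≡
    with halts-while Inv body (≤-refl , u≡ , d≡ , L , R , λ v n≤v → contradiction (toℕ<n v) (≤⇒≯ n≤v))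
    where
    Inv : ℕ → Memory → Set
    Inv μ M = μ ≤ n × M at uL ≡ μ × M at dL ≡ d ×
              ∃ λ L → Rep M T c L × (∀ v → μ ≤ toℕ v → L v ≡ [])
    body : ∀ {μ M} → Inv μ M → ∃ λ x → M ⊢ û ⇓ x ×
             (x ≢ 0 → wp clear (λ M′ → ∃ λ μ′ → μ′ < μ × Inv μ′ M′) M)
    body {zero}  (_ , u≡ , _) = 0 , û⇓ u≡ 0<S , λ 0≢0 → contradiction refl 0≢0
    body {suc μ} {M} (μ<n , u≡ , d≡ , L , R , empty) =
      suc μ , û⇓ u≡ (≤-<-trans μ<n n<S) , λ _ →
        addr uL , μ , scalar⇓ (suc (suc zero))
          , bin (û⇓ u≡ (≤-<-trans μ<n n<S)) (lit 1<S) μ<S ,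
        addr (degL v) , 0 , deg⇓ (n≡ R₁) (û⇓ (trans u≡₁ (sym v≡)) (vertex<S v)) , lit 0<S ,
        μ , ≤-refl , <⇒≤ μ<n
          , trans (at-other M₁ (degL v) _ λ ()) u≡₁
          , trans (at-other M₁ (degL v) _ λ ()) (trans (at-other M uL _ λ ()) d≡)
          , updateAt L v (const []) , rep-shrink [] tt R₁
          , updateAt-elim (λ x l → μ ≤ toℕ x → l ≡ []) (λ _ → refl)
              (λ x x≢v μ≤x → empty x (≤∧≢⇒< μ≤x
                (λ μ≡x → x≢v (toℕ-injective (trans (sym μ≡x) (sym v≡))))))
      where
      v = fromℕ< μ<n
      v≡ : toℕ v ≡ μ
      v≡ = toℕ-fromℕ< μ<n
      μ<S : μ < S
      μ<S = <-trans μ<n n<S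
      M₁ = M [ addr uL ↦ μ ]
      R₁ : Rep M₁ T c L
      R₁ = rep-scratch zero μ R
      u≡₁ : M₁ at uL ≡ μ
      u≡₁ = at-same M uL μ
  ... | _ , _ , run , t≤ , (_ , _ , u≡μ , d≡′ , L′ , R′ , empty) , û⇓0 =
    _ , _ , run , t≤ , d≡′ , L′ , R′ , λ v → empty v
      (subst (_≤ toℕ v) (trans (sym (û⇓0⇒u≡0 û⇓0)) u≡μ) z≤n)

  Between : List (Edge n) → Fin n → List (Fin n) → Memory → Set
  Between T c s M = Cleared T c M × Search T c s

  PassResult : List (Edge n) → Memory → Set
  PassResult T M =
    (M at dL ≡ 1 × Complete M) ⊎
    (M at dL ≡ 0 × ∃ λ T′ → ∃ λ c → ∃ λ s → Between T′ c s M × length T′ ≡ k + length T)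

  open StreamingAlgorithm dfs
  open Execution S dfs using (Pass; pass; Passes; stop; next)

  stop-or-continue : ∀ {T M} → Ended T M →
    Halts (lit uCell ≔ n̂ ⨾ while û clear) M (steps (lit uCell ≔ n̂) + iterations û clear n)
      (PassResult T)
  stop-or-continue {T} {M} (T′ , c′ , s′ , L , R , Sr , outcome) =
    halts-seq
      (wp⇒halts (lit uCell ≔ n̂) {λ M′ → M′ ≡ M [ addr uL ↦ n ]} (_ , n , scalar⇓ (suc (suc zero)) , n̂⇓ (n≡ R) , refl))
      λ { refl → finish outcome }
    where
    M₁ = M [ addr uL ↦ n ]
    cleared : ∀ {d} → M at dL ≡ d → Halts (while û clear) M₁ (iterations û clear n)
                (λ M′ → M′ at dL ≡ d × Cleared T′ c′ M′)
    cleared d≡ = clear-loop (rep-scratch zero n R) (at-same M uL n)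
                            (trans (at-other M uL n λ ()) d≡)
    finish : Outcome T T′ M → Halts (while û clear) M₁ (iterations û clear n) (PassResult T)
    finish (inj₁ (d≡1 , all)) with cleared d≡1
    ... | _ , _ , run , t≤ , d≡ , L′ , R′ , _ =
      _ , _ , run , t≤ , inj₁ (d≡ , T′ , c′ , s′ , L′ , R′ , Sr , all)
    finish (inj₂ (d≡0 , len)) with cleared d≡0
    ... | _ , _ , run , t≤ , d≡ , cl =
      _ , _ , run , t≤ , inj₂ (d≡ , T′ , c′ , s′ , (cl , Sr) , len)

  module _ {T : List (Edge n)} {c : Fin n} {s : List (Fin n)} {es : List (Edge n)}
           (stream : SimpleStream G es) where
    open SimpleStream stream
    open Collecting k (visited T)

    endPass-halts : ∀ {M O} → Rep M T c O → CollectedAll (arcs es []) O → Search T c s →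
                    M at dL ≡ 0 → Halts endPass M (endTime n (2 * total O + suc (length s))) (PassResult T)
    endPass-halts {M} {O} R C Sr d≡0 =
      halts-seq
        (wp⇒halts (lit uCell ≔ k̂) {λ M′ → M′ ≡ M [ addr uL ↦ k ]} (_ , k , scalar⇓ (suc (suc zero)) , k̂⇓ (k≡ R) , refl))
        λ { refl → halts-seq (advance-loop running) (stop-or-continue {T}) }
      where
      adj⇒as : ∀ {u v} → Adj G u v → (u , v) ∈ arcs es []
      adj⇒as u~v = ∈-arcs⁺ es (inj₁ (adj⇒∈ u~v))
      as⇒adj : ∀ {u v} → (u , v) ∈ arcs es [] → Adj G u v
      as⇒adj uv∈ with ∈-arcs⁻ es uv∈
      ... | inj₁ uv∈es = ∈⇒adj uv∈es
      open DFSLoop T C adj⇒as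
      running : Running [] c s O k (M [ addr uL ↦ k ])
      running = record
        { rep = rep-scratch zero k R ; search = Sr ; budget = refl
        ; u≡ = at-same M uL k ; d≡ = trans (at-other M uL k λ ()) d≡0
        ; pending = λ v w∈ → inj₂ w∈
        ; stored⇒adj = λ v w∈ → as⇒adj (proj₂ (Collected.sound (CollectedAll.collected C v) w∈))
        }

    pass-halts : ∀ {M} → Between T c s M → M at dL ≡ 0 →
                 ∃ λ M′ → ∃ λ t → Pass es M t M′ × t ≤ passTime n (size G) × PassResult T M′
    pass-halts ((L , R , empty) , Sr) d≡0
      with read es {as = []} R (collect-none empty (total-empty L empty)) distinct no-loops (All.tabulate λ _ ())
    ... | M₁ , _ , run₁ , t≤₁ , d₁ , O , R₁ , C
      with endPass-halts R₁ C Sr (trans d₁ d≡0)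
    ... | M₂ , _ , run₂ , t≤₂ , result =
      M₂ , _ , pass run₁ run₂
        , subst (λ m → _ ≤ passTime n m) length≡ (+-mono-≤ t≤₁ (≤-trans t≤₂
            (+-monoʳ-≤ (steps (lit uCell ≔ k̂))
              (+-monoˡ-≤ _ (iterations-mono û advance potential≤)))))
        , result
      where
      open ≤-Reasoning
      potential≤ : 2 * total O + suc (length s) ≤ 4 * length es + n
      potential≤ = begin
        2 * total O + suc (length s)       ≤⟨ +-mono-≤ (*-monoʳ-≤ 2 (CollectedAll.total≤ C)) (depth Sr) ⟩
        2 * length (arcs es []) + length T ≡⟨ cong₂ _+_ (cong (2 *_) (length-arcs es [])) (sym (length-map proj₁ T)) ⟩
        2 * (2 * length es + 0) + length (visited T) ≤⟨ +-monoʳ-≤ _ (unique⇒length≤n (unique Sr)) ⟩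
        2 * (2 * length es + 0) + n        ≡⟨ cong (_+ n) (quadruple (length es)) ⟩
        4 * length es + n                  ∎
        where
        quadruple : ∀ m → 2 * (2 * m + 0) ≡ 4 * m
        quadruple = solve-∀

  -- `g` is the number of passes still allowed. An unfinished pass trades one of them for `k`
  -- visited vertices, which preserves the strict inequality; with none left, more than n distinct
  -- vertices would be visited.
  passes-halt : {stream : ℕ → List (Edge n)} → (∀ i → Presents (stream i) G) →
    ∀ g i {T c s M} → Between T c s M → M at dL ≡ 0 → n < length T + g * k →
    ∃ λ ts → ∃ λ M′ → Passes stream i M ts M′ × length ts ≤ g ×
      All (_≤ passTime n (size G)) ts × Complete M′
  passes-halt pres zero i {T} (_ , Sr) _ n< =
    contradiction (subst₂ _≤_ (length-map proj₁ T) refl (unique⇒length≤n (unique Sr)))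
                  (<⇒≱ (subst (n <_) (+-identityʳ (length T)) n<))
  passes-halt pres (suc g) i {T} {M = M} B d≡0 n<
    with pass-halts (presents⇒simple {G = G} (pres i)) B d≡0
  ... | M₁ , t , run₁ , t≤ , inj₁ (d≡1 , complete) =
    _ , M₁ , next (at-done M d≡0) run₁ (stop (λ d≡ → 1+n≢0 (trans (sym (at-done M₁ d≡1)) d≡)))
      , s≤s z≤n , t≤ ∷ []
      , complete
    where
    at-done : ∀ M {d} → M at dL ≡ d → M doneCell ≡ d
    at-done M = trans (cong M (sym (addr-scalar (suc (suc (suc (suc zero)))))))
  ... | M₁ , t , run₁ , t≤ , inj₂ (d≡0′ , T′ , _ , _ , B′ , len)
    with passes-halt pres g (suc i) B′ d≡0′ (subst (n <_) (begin
           length T + suc g * k     ≡⟨ +-assoc (length T) k (g * k) ⟨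
           length T + k + g * k     ≡⟨ cong (_+ g * k) (+-comm (length T) k) ⟩
           k + length T + g * k     ≡⟨ cong (_+ g * k) len ⟨
           length T′ + g * k        ∎) n<)
    where open ≡-Reasoning
  ... | _ , M₂ , run₂ , ts≤ , all≤ , complete =
    _ , M₂ , next (trans (cong M (sym (addr-scalar (suc (suc (suc (suc zero))))))) d≡0) run₁ run₂
      , s≤s ts≤ , t≤ ∷ all≤
      , complete

  -- Initialisation and the output tree

  Started : Memory → Set
  Started M = M at dL ≡ 0 × Between ((root , root) ∷ []) root [] M

  start-halts : Halts start (initial n k) (steps start) Started
  start-halts = wp⇒halts start {Started} {M₀}
    ( addr (visL root) , 1
    , vis⇓ (trans (at-M₀ nL) (trans (at-other M₀′ kL k λ ()) (at-same (λ _ → 0) nL n)))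
           (subst (_ ⊢ lit 0 ⇓_) (sym root≡0) (lit 0<S))
    , lit 1<S
    , trans (at-other M₀ (visL root) 1 λ ()) (blank dL (λ ()) (λ ()))
    , ((λ _ → []) , record
        { n≡ = trans (at-other M₀ (visL root) 1 λ ())
                 (trans (at-M₀ nL) (trans (at-other M₀′ kL k λ ()) (at-same (λ _ → 0) nL n)))
        ; k≡ = trans (at-other M₀ (visL root) 1 λ ()) (trans (at-M₀ kL) (at-same M₀′ kL k))
        ; top≡ = trans (at-other M₀ (visL root) 1 λ ()) (trans (blank topL (λ ()) (λ ())) (sym root≡0))
        ; par≡ = λ { (here refl) → trans (at-other M₀ (visL root) 1 λ ())
                                     (trans (blank (parL root) (λ ()) (λ ())) (sym root≡0)) }
        ; vis≡ = mark
        ; deg≡ = λ v → trans (at-other M₀ (visL root) 1 λ ()) (blank (degL v) (λ ()) (λ ()))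
        ; adj≡ = λ v → tt
        } , λ _ → refl)
    , search-start )
    where
    M₀ = initial n k
    M₀′ = (λ _ → 0) [ addr nL ↦ n ]
    at-M₀ : ∀ l → M₀ at l ≡ (M₀′ [ addr kL ↦ k ]) at l
    at-M₀ l = sym (cong₂ (λ p q → (((λ _ → 0) [ p ↦ n ]) [ q ↦ k ]) at l)
                (addr-scalar zero) (addr-scalar (suc zero)))
    blank : ∀ l → l ≢ nL → l ≢ kL → M₀ at l ≡ 0
    blank l l≢n l≢k = trans (at-M₀ l) (trans (at-other M₀′ kL k l≢k) (at-other (λ _ → 0) nL n l≢n))
    mark : ∀ v → Mark ((root , root) ∷ []) v ((M₀ [ addr (visL root) ↦ 1 ]) at visL v)
    mark v with v ≟ root
    ... | yes refl = inj₁ (here refl , at-same M₀ (visL root) 1)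
    ... | no v≢root = inj₂ ((λ { (here v≡) → v≢root v≡ }) ,
      trans (at-other M₀ (visL root) 1 λ { refl → v≢root refl }) (blank (visL v) (λ ()) (λ ())))

  complete⇒DFSTree : ∀ {M} → Complete M → ∃ λ parent → Outputs M parent × IsDFSTree G root parent
  complete⇒DFSTree {M} (T , _ , _ , _ , R , Sr , all) =
    parent , (λ v → trans (cong M (sym (addr-par v))) (par≡ R (parent∈ v))) ,
    -- Any two parents that `T` lists for `x` are the content of the same cell, so they agree.
    search⇒DFSTree Sr all (λ {x} xy → toℕ-injective (trans (sym (par≡ R (parent∈ x))) (par≡ R xy)))
    where
    entry : ∀ v → ∃ λ y → (v , y) ∈ T
    entry v with ∈-map⁻ proj₁ (all v)
    ... | (_ , y) , vy∈ , refl = y , vy∈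
    parent : Fin n → Fin n
    parent v = proj₁ (entry v)
    parent∈ : ∀ v → (v , parent v) ∈ T
    parent∈ v = proj₂ (entry v)

-- Bounds on passes, time and space, and the theorem

n≤⌈n/k⌉*k : ∀ n k .{{_ : NonZero k}} → n ≤ ⌈ n / k ⌉ * k
n≤⌈n/k⌉*k n k = +-cancelˡ-≤ (pred k) _ _ (begin
  pred k + n                                  ≡⟨ +-comm (pred k) n ⟩
  n + pred k                                  ≡⟨ m≡m%n+[m/n]*n (n + pred k) k ⟩
  (n + pred k) % k + (n + pred k) / k * k     ≤⟨ +-monoˡ-≤ _ (suc[m]≤n⇒m≤pred[n] (m%n<n (n + pred k) k)) ⟩
  pred k + (n + pred k) / k * k               ∎)
  where open ≤-Reasoning

-- With x the maximum of m and 1, connectedness gives n ≤ 2x. Hence 2x rounds of clearing suffice,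
-- and at most 4m + n ≤ 6x rounds of searching.
passFactor : ℕ
passFactor = suc (steps onEdge) + (steps (lit uCell ≔ k̂) + (iterations û advance 6 +
             (steps (lit uCell ≔ n̂) + iterations û clear 2)))
  where open StreamingAlgorithm dfs

passTime≤ : ∀ {n m x} → n ≤ 2 * x → m ≤ x → 1 ≤ x → passTime n m ≤ passFactor * x
passTime≤ {n} {m} {x} n≤ m≤ 1≤x = begin
  m * a + (b + ((w + (4 * m + n) * c) + (d + (w + n * e))))
    ≤⟨ +-mono-≤ (*-monoˡ-≤ a m≤) (+-mono-≤ (scale b) (+-mono-≤
         (+-mono-≤ (scale w) (*-monoˡ-≤ c (+-mono-≤ (*-monoʳ-≤ 4 m≤) n≤)))
         (+-mono-≤ (scale d) (+-mono-≤ (scale w) (*-monoˡ-≤ e n≤))))) ⟩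
  x * a + (b * x + ((w * x + (4 * x + 2 * x) * c) + (d * x + (w * x + 2 * x * e))))
    ≡⟨ collect x a b c d e w ⟩
  (a + (b + ((w + 6 * c) + (d + (w + 2 * e))))) * x ∎
  where
  open ≤-Reasoning
  open StreamingAlgorithm dfs
  a = suc (steps onEdge)
  b = steps (lit uCell ≔ k̂)
  c = suc (cost û) + steps advance
  d = steps (lit uCell ≔ n̂)
  e = suc (cost û) + steps clear
  w = suc (cost û)
  scale : ∀ y → y ≤ y * x
  scale y = m≤m*n y x {{>-nonZero 1≤x}}
  collect : ∀ x a b c d e w →
    x * a + (b * x + ((w * x + (4 * x + 2 * x) * c) + (d * x + (w * x + 2 * x * e)))) ≡
    (a + (b + ((w + 6 * c) + (d + (w + 2 * e))))) * x
  collect = solve-∀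

-- Six single cells, three regions of n cells and the nk slots: each of these 6 + 3 + 1 terms is at
-- most nk.
cells≤10nk : ∀ n k .{{_ : NonZero n}} .{{_ : NonZero k}} → Layout.cells n k ≤ 10 * (n * k)
cells≤10nk n k = begin
  5 + (n + (1 + (n + (n + n * k))))  ≡⟨ collect n (n * k) ⟩
  6 * 1 + 3 * n + n * k              ≤⟨ +-monoˡ-≤ (n * k) (+-mono-≤ (*-monoʳ-≤ 6 1≤nk) (*-monoʳ-≤ 3 (m≤m*n n k))) ⟩
  6 * (n * k) + 3 * (n * k) + n * k  ≡⟨ sum (n * k) ⟩
  10 * (n * k)                       ∎
  where
  open ≤-Reasoning
  1≤nk : 1 ≤ n * k
  1≤nk = *-mono-≤ (>-nonZero⁻¹ n) (>-nonZero⁻¹ k)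
  collect : ∀ n p → 5 + (n + (1 + (n + (n + p)))) ≡ 6 * 1 + 3 * n + p
  collect = solve-∀
  sum : ∀ p → 6 * p + 3 * p + p ≡ 10 * p
  sum = solve-∀

theorem1p1 : Σ[ A ∈ StreamingAlgorithm ] Σ[ c ∈ ℕ ]
    ((k : ℕ) .{{_ : NonZero k}} (n : ℕ) .{{_ : NonZero n}}
    (G : Graph n) → Connected G →
    (stream : ℕ → List (Edge n)) → (∀ i → Presents (stream i) G) →
    ∃[ t₀ ] ∃[ ts ] ∃[ M ]
    ( Run (c * (n * k)) A k stream t₀ ts M
    × length ts ≤ ⌈ n / k ⌉
    × All (_≤ c * ((size G ⊔ 1) * α (size G) n)) (t₀ ∷ ts)
    × (Σ[ root ∈ Fin n ] Σ[ parent ∈ (Fin n → Fin n) ]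
    (Outputs M parent × IsDFSTree G root parent)) ))
theorem1p1 = dfs , factor , solve
  where
  open StreamingAlgorithm dfs
  -- One constant has to serve for the capacity, the preprocessing and the time per pass; the sum
  -- dominates the three separate constants.
  factor = 10 + (steps start + passFactor)
  solve : (k : ℕ) .{{_ : NonZero k}} (n : ℕ) .{{_ : NonZero n}}
    (G : Graph n) → Connected G →
    (stream : ℕ → List (Edge n)) → (∀ i → Presents (stream i) G) →
    ∃[ t₀ ] ∃[ ts ] ∃[ M ]
    ( Run (factor * (n * k)) dfs k stream t₀ ts M
    × length ts ≤ ⌈ n / k ⌉
    × All (_≤ factor * ((size G ⊔ 1) * α (size G) n)) (t₀ ∷ ts)
    × (Σ[ root ∈ Fin n ] Σ[ parent ∈ (Fin n → Fin n) ]
    (Outputs M parent × IsDFSTree G root parent)) )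
  solve k n G connected stream presents =
    let M₀ , t₀ , run₀ , t₀≤ , d≡0 , B = start-halts
        ts , M , runs , ts≤ , all≤ , complete =
          -- The root is visited before the first pass; this one vertex makes the inequality strict.
          passes-halt presents ⌈ n / k ⌉ 0 B d≡0 (s≤s (n≤⌈n/k⌉*k n k))
    in t₀ , ts , M
     , Execution.run (≤-trans (+-monoʳ-≤ 5 (m≤m+n n _)) size≤S) run₀ runs
     , ts≤
     , ≤-trans t₀≤ (≤-trans (≤-trans (m≤m+n (steps start) passFactor) (m≤n+m (steps start + passFactor) 10))
           (m≤m*n factor _ {{>-nonZero 1≤x*α}}))
       ∷ All.map (λ t≤ → ≤-trans t≤ (≤-trans
           (passTime≤ (connected⇒n≤2m G connected) (m≤m⊔n (size G) 1) (m≤n⊔m (size G) 1))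
           (*-mono-≤ (≤-trans (m≤n+m passFactor (steps start)) (m≤n+m (steps start + passFactor) 10)) x≤x*α))) all≤
     , root , complete⇒DFSTree complete
    where
    S = factor * (n * k)
    size≤S : Layout.cells n k ≤ S
    size≤S = ≤-trans (cells≤10nk n k) (*-monoˡ-≤ (n * k) (m≤m+n 10 (steps start + passFactor)))
    root = fromℕ< (>-nonZero⁻¹ n)
    open Passes n k S size≤S G root (toℕ-fromℕ< _) connected
    -- `α` is a successor, hence at least 1, so a time linear in the maximum of m and 1 meets the
    -- stated bound.
    x≤x*α : size G ⊔ 1 ≤ (size G ⊔ 1) * α (size G) n
    x≤x*α = m≤m*n (size G ⊔ 1) (α (size G) n)
    1≤x*α : 1 ≤ (size G ⊔ 1) * α (size G) n
    1≤x*α = ≤-trans (m≤n⊔m (size G) 1) x≤x*α
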